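{- The theory $\mathrm{RCA}_0^{\Omega}$ proves the equivalences $$\Pi^0_1\text{ -TRANS}\leftrightarrow \Sigma^0_1\text{ -SEP}^{*}\leftrightarrow \text{E-U}\Sigma^0_1\text{ -SEP}^{\mathrm{st}}\leftrightarrow (\exists^{2})^{\mathrm{st}}.$$
   Context: BASE THEORY. Finite types: $0$ (natural numbers), $\sigma\to\tau$, and $\sigma^{*}$ (finite sequences of objects of type $\sigma$); $1=0\to 0$, $2=1\to 0$, $3=2\to 0$. Superscripts indicate types; tuples are coded as single objects where convenient. Equality $=_0$ is primitive; for $\tau=\tau_1\to\dots\to\tau_k\to 0$, $x=_\tau y$ means $(\forall z_1\dots z_k)(xz_1\dots z_k=_0 yz_1\dots z_k)$. $\mathrm{RCA}_0^{\omega}$ is Kohlenbach's higher-order base theory: classical arithmetic in all finite types with combinators, zero, successor, the recursor $R_0$ (primitive recursion with type $0$ values), quantifier-free induction, extensionality $x=_\rho y\to\varphi(x)=_\tau\varphi(y)$ for all $\varphi^{\rho\to\tau}$, and $\mathrm{QF\text{ - }AC}^{1,0}$, where $\mathrm{QF\text{ - }AC}^{\sigma,\tau}$ is $(\forall x^\sigma)(\exists y^\tau)A_0(x,y)\to(\exists F^{\sigma\to\tau})(\forall x)A_0(x,F(x))$ for quantifier-free $A_0$. $\mathrm{RCA}_0^{\Omega}$ extends $\mathrm{RCA}_0^{\omega}$ (with the types $\sigma^*$) by a predicate $\mathrm{st}$ ("is standard") for each type. A formula is internal if it does not contain $\mathrm{st}$; $(\forall^{\mathrm{st}}x)A$ is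 $(\forall x)(\mathrm{st}(x)\to A)$, $(\exists^{\mathrm{st}}x)A$ is $(\exists x)(\mathrm{st}(x)\wedge A)$; $N\in\Omega$ means $\neg\mathrm{st}(N^0)$. Axioms: (i) standardness respects equality, closed terms are standard, a standard functional applied to a standard object is standard, and numbers below a standard number are standard; (ii) Idealization: $(\forall^{\mathrm{st}}x^{\sigma^*})(\exists y^\tau)(\forall z\in x)\varphi(z,y)\to(\exists y)(\forall^{\mathrm{st}}z^{\sigma})\varphi(z,y)$ for internal $\varphi$; (iii) $\mathrm{HAC}_{\mathrm{int}}$: $(\forall^{\mathrm{st}}x^{\rho})(\exists^{\mathrm{st}}y^{\tau})\varphi(x,y)\to(\exists^{\mathrm{st}}\Phi^{\rho\to\tau^*})(\forall^{\mathrm{st}}x)(\exists y\in\Phi(x))\varphi(x,y)$ for internal $\varphi$; (iv) $\mathrm{PF\text{ - }TP}_\forall$: $(\forall^{\mathrm{st}}x^\tau)\varphi(x)\to(\forall x^\tau)\varphi(x)$ for internal $\varphi(x)$ with no parameters other than $x$; (v) for certain functionals uniquely specified by a parameter-free internal formula $D$ (e.g. the one in $(\exists^2)$), a constant $\Xi_0$ with the axiom $\mathrm{st}(\Xi_0)\wedge(\forall^{\mathrm{st}}\Xi)[D^{\mathrm{st}}(\Xi)\to \Xi_0$ and $\Xi$ agree on all standard inputs$]$; these constants do not count as parameters in (iv). NOTATION. $A^{\mathrm{st}}$ is $A$ with all quantifiers (except bounded number quantifiers) relativised to $\mathrm{st}$. For $\tau=\tau_1\to\dots\to\tau_k\to 0$,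 $x\approx_\tau y$ means $(\forall^{\mathrm{st}}z_1^{\tau_1}\dots z_k^{\tau_k})(xz_1\dots z_k=_0yz_1\dots z_k)$. If $\mathrm{AX}^{\mathrm{st}}$ is $(\exists^{\mathrm{st}}\Phi^{\rho\to\tau})A^{\mathrm{st}}(\Phi)$, then $\text{E-AX}^{\mathrm{st}}$ states that there is such a standard $\Phi$ which is moreover standard extensional: $(\forall^{\mathrm{st}}x^\rho,y^\rho)(x\approx_\rho y\to\Phi(x)\approx_\tau\Phi(y))$ (for several arguments: in each of them). Sets $Z^1$ are given by characteristic functions. PRINCIPLES. $(\exists^2)$: $(\exists\varphi^2)(\forall g^1)[(\exists x^0)g(x)=0\leftrightarrow\varphi(g)=0]$. $\Pi^0_1\text{ -TRANS}$: $(\forall^{\mathrm{st}}f^1)[(\forall^{\mathrm{st}}n^0)f(n)=0\to(\forall n^0)f(n)=0]$. $\Sigma^0_1\text{ -SEP}^*$: for all standard $f_1^1,f_2^1$ and $\varphi_i(n)\equiv(\exists n_i)(f_i(n_i,n)=0)$ such that $(\forall^{\mathrm{st}}n)\neg[\varphi_1^{\mathrm{st}}(n)\wedge\varphi_2^{\mathrm{st}}(n)]$, there is a standard $Z^1$ such that $(\forall n^0)[(\varphi_1(n)\to n\notin Z)\wedge(\varphi_2(n)\to n\in Z)]$. $\mathrm{U}\Sigma^0_1\text{ -SEP}$: for $\varphi_i(n,f)\equiv(\exists n_i)(f(n_i,n)=0)$, $i=1,2$, $$(\exists F^{(1\times1\times0)\to0})(\forall f^1,g^1)\big[(\forall n)\neg[\varphi_1(n,f)\wedge\varphi_2(n,g)]\to(\forall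 n)[\varphi_1(n,f)\to F(f,g,n)=1]\wedge(\forall n)[\varphi_2(n,g)\to F(f,g,n)=0]\big].$$ -}

module Defs where

open import Data.Empty using (⊥)
open import Data.List.Base using (List; []; _∷_; map)
open import Data.List.Membership.Propositional using (_∈_)
open import Data.List.Relation.Unary.Any using (here; there)
open import Data.Maybe.Base using (Maybe; just; nothing)
open import Data.Product.Base using (_×_; _,_)
open import Data.Unit.Base using (⊤; tt)
open import Relation.Binary.PropositionalEquality using (_≡_; refl)

infixr 30 _⟶_
infix  40 _*
infixl 25 _·_
infixl 22 _+′_
infix  20 _≐_ _=′_ _≈_ _≤′_ _<′_ _∈′_ _∈ˢ_ _∉ˢ_
infix  19 ¬′_
infixr 18 _∧_
infixr 17 _∨_
infixr 16 _⇒_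
infix  15 _⇔_
infixr 14 ∀[_]_ ∃[_]_ ∀ˢᵗ[_]_ ∃ˢᵗ[_]_
infix  4  _⊢[_]_ _⊢_

data Ty : Set where
  𝟎   : Ty
  _⟶_ : Ty → Ty → Ty
  _*  : Ty → Ty

𝟏 𝟐 : Ty
𝟏 = 𝟎 ⟶ 𝟎
𝟐 = 𝟏 ⟶ 𝟎

Cxt : Set
Cxt = List Ty

-- The constants which a language has in addition to those of arithmetic.
record Sig : Set₁ where
  field
    Name : Set
    type : Name → Ty

open Sig public

∅ : Sig
∅ = record { Name = ⊥ ; type = λ () }

-- The sequence types are a definitional extension: an element of σ * is
-- determined by its length and its entries (see Eq), and  tab f n  is
-- the sequence ⟨ f 0 , … , f (n - 1) ⟩.  The empty sequence, cons and
-- concatenation are definable from tab.  Entries at positions beyond the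
-- length are left unspecified.
data Const (S : Sig) : Ty → Set where
  Πᶜ  : ∀ ρ τ → Const S (ρ ⟶ τ ⟶ ρ)
  Σᶜ  : ∀ δ ρ τ → Const S ((δ ⟶ ρ ⟶ τ) ⟶ (δ ⟶ ρ) ⟶ δ ⟶ τ)
  0ᶜ  : Const S 𝟎
  Sᶜ  : Const S (𝟎 ⟶ 𝟎)
  R₀  : Const S (𝟎 ⟶ 𝟎 ⟶ (𝟎 ⟶ 𝟎 ⟶ 𝟎) ⟶ 𝟎)
  len : ∀ σ → Const S (σ * ⟶ 𝟎)
  at  : ∀ σ → Const S (σ * ⟶ 𝟎 ⟶ σ)
  tab : ∀ σ → Const S ((𝟎 ⟶ σ) ⟶ 𝟎 ⟶ σ *)
  Ξ   : (i : Name S) → Const S (type S i)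

data Tm (S : Sig) (Γ : Cxt) : Ty → Set where
  var : ∀ {τ} → τ ∈ Γ → Tm S Γ τ
  con : ∀ {τ} → Const S τ → Tm S Γ τ
  _·_ : ∀ {σ τ} → Tm S Γ (σ ⟶ τ) → Tm S Γ σ → Tm S Γ τ

data Fm (S : Sig) (Γ : Cxt) : Set where
  _≐_         : Tm S Γ 𝟎 → Tm S Γ 𝟎 → Fm S Γ
  st          : ∀ {τ} → Tm S Γ τ → Fm S Γ
  ⊥′          : Fm S Γ
  _∧_ _∨_ _⇒_ : Fm S Γ → Fm S Γ → Fm S Γ
  ∀[_]_ ∃[_]_ : ∀ τ → Fm S (τ ∷ Γ) → Fm S Γ

private
  variable
    S   : Sig
    Γ Δ : Cxt
    σ τ : Ty

Ren : Cxt → Cxt → Set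
Ren Γ Δ = ∀ {τ} → τ ∈ Γ → τ ∈ Δ

liftR : Ren Γ Δ → Ren (σ ∷ Γ) (σ ∷ Δ)
liftR r (here p)  = here p
liftR r (there x) = there (r x)

renTm : Ren Γ Δ → Tm S Γ τ → Tm S Δ τ
renTm r (var x) = var (r x)
renTm r (con c) = con c
renTm r (t · u) = renTm r t · renTm r u

ren : Ren Γ Δ → Fm S Γ → Fm S Δ
ren r (s ≐ t)    = renTm r s ≐ renTm r t
ren r (st t)     = st (renTm r t)
ren r ⊥′         = ⊥′
ren r (A ∧ B)    = ren r A ∧ ren r B
ren r (A ∨ B)    = ren r A ∨ ren r B
ren r (A ⇒ B)    = ren r A ⇒ ren r B
ren r (∀[ τ ] A) = ∀[ τ ] ren (liftR r) A
ren r (∃[ τ ] A) = ∃[ τ ] ren (liftR r) A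

wk : Tm S Γ τ → Tm S (σ ∷ Γ) τ
wk = renTm there

wkF : Fm S Γ → Fm S (σ ∷ Γ)
wkF = ren there

-- Closed terms and closed formulas, read in an arbitrary context.
⌈_⌉ : Tm S [] τ → Tm S Γ τ
⌈ t ⌉ = renTm (λ ()) t

⌈_⌉F : Fm S [] → Fm S Γ
⌈ A ⌉F = ren (λ ()) A

Sub : Sig → Cxt → Cxt → Set
Sub S Γ Δ = ∀ {τ} → τ ∈ Γ → Tm S Δ τ

liftS : Sub S Γ Δ → Sub S (σ ∷ Γ) (σ ∷ Δ)
liftS s (here p)  = var (here p)
liftS s (there x) = wk (s x)

subTm : Sub S Γ Δ → Tm S Γ τ → Tm S Δ τ
subTm s (var x) = s x
subTm s (con c) = con c
subTm s (t · u) = subTm s t · subTm s u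

sub : Sub S Γ Δ → Fm S Γ → Fm S Δ
sub s (t ≐ u)    = subTm s t ≐ subTm s u
sub s (st t)     = st (subTm s t)
sub s ⊥′         = ⊥′
sub s (A ∧ B)    = sub s A ∧ sub s B
sub s (A ∨ B)    = sub s A ∨ sub s B
sub s (A ⇒ B)    = sub s A ⇒ sub s B
sub s (∀[ τ ] A) = ∀[ τ ] sub (liftS s) A
sub s (∃[ τ ] A) = ∃[ τ ] sub (liftS s) A

infixl 6 _▹_
infix 35 _[_] _[_]₁
_▹_ : Sub S Γ Δ → Tm S Δ σ → Sub S (σ ∷ Γ) Δ
(s ▹ t) (here refl) = t
(s ▹ t) (there x)   = s x

_[_] : Fm S (σ ∷ Γ) → Tm S Γ σ → Fm S Γ
A [ t ] = sub (var ▹ t) A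

-- Instantiation of the only free variable.
_[_]₁ : Fm S (σ ∷ []) → Tm S Γ σ → Fm S Γ
A [ t ]₁ = sub ((λ ()) ▹ t) A

embConst : Const ∅ τ → Const S τ
embConst (Πᶜ ρ τ)   = Πᶜ ρ τ
embConst (Σᶜ δ ρ τ) = Σᶜ δ ρ τ
embConst 0ᶜ         = 0ᶜ
embConst Sᶜ         = Sᶜ
embConst R₀         = R₀
embConst (len σ)    = len σ
embConst (at σ)     = at σ
embConst (tab σ)    = tab σ

embTm : Tm ∅ Γ τ → Tm S Γ τ
embTm (var x) = var x
embTm (con c) = con (embConst c)
embTm (t · u) = embTm t · embTm u

emb : Fm ∅ Γ → Fm S Γ
emb (s ≐ t)    = embTm s ≐ embTm t
emb (st t)     = st (embTm t)
emb ⊥′         = ⊥′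
emb (A ∧ B)    = emb A ∧ emb B
emb (A ∨ B)    = emb A ∨ emb B
emb (A ⇒ B)    = emb A ⇒ emb B
emb (∀[ τ ] A) = ∀[ τ ] emb A
emb (∃[ τ ] A) = ∃[ τ ] emb A

v₀ : ∀ {a} → Tm S (a ∷ Γ) a
v₀ = var (here refl)

v₁ : ∀ {a b} → Tm S (a ∷ b ∷ Γ) b
v₁ = wk v₀

v₂ : ∀ {a b c} → Tm S (a ∷ b ∷ c ∷ Γ) c
v₂ = wk v₁

v₃ : ∀ {a b c d} → Tm S (a ∷ b ∷ c ∷ d ∷ Γ) d
v₃ = wk v₂

-- Abstraction, by translation to combinators.
ƛ : Tm S (σ ∷ Γ) τ → Tm S Γ (σ ⟶ τ)
ƛ {σ = σ} (var (here refl)) = con (Σᶜ σ (σ ⟶ σ) σ) · con (Πᶜ σ (σ ⟶ σ)) · con (Πᶜ σ σ)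
ƛ {σ = σ} {τ = τ} (var (there x)) = con (Πᶜ τ σ) · var x
ƛ {σ = σ} {τ = τ} (con c) = con (Πᶜ τ σ) · con c
ƛ {σ = σ} {τ = τ} (_·_ {ρ} t u) = con (Σᶜ σ ρ τ) · ƛ t · ƛ u

O : Tm S Γ 𝟎
O = con 0ᶜ

suc′ : Tm S Γ 𝟎 → Tm S Γ 𝟎
suc′ t = con Sᶜ · t

-- 0 + t = t and (n + 1) + t = (n + t) + 1.
_+′_ : Tm S Γ 𝟎 → Tm S Γ 𝟎 → Tm S Γ 𝟎
s +′ t = con R₀ · s · t · ƛ (ƛ (suc′ v₁))

-- triangle 0 = 0 and triangle (n + 1) = (n + 1) + triangle n.
triangle : Tm S Γ 𝟎 → Tm S Γ 𝟎
triangle t = con R₀ · t · O · ƛ (ƛ (suc′ v₀ +′ v₁))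

-- The Cantor pairing  (x + y)(x + y + 1)/2 + x.
pair : Tm S Γ 𝟎 → Tm S Γ 𝟎 → Tm S Γ 𝟎
pair x y = triangle (x +′ y) +′ x

¬′_ : Fm S Γ → Fm S Γ
¬′ A = A ⇒ ⊥′

⊤′ : Fm S Γ
⊤′ = ¬′ ⊥′

_⇔_ : Fm S Γ → Fm S Γ → Fm S Γ
A ⇔ B = (A ⇒ B) ∧ (B ⇒ A)

_≤′_ _<′_ : Tm S Γ 𝟎 → Tm S Γ 𝟎 → Fm S Γ
s ≤′ t = ∃[ 𝟎 ] v₀ +′ wk s ≐ wk t
s <′ t = suc′ s ≤′ t

-- Equality of all types, defined from equality of numbers.
Eq : ∀ τ → Tm S Γ τ → Tm S Γ τ → Fm S Γ
Eq 𝟎       s t = s ≐ t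
Eq (ρ ⟶ τ) s t = ∀[ ρ ] Eq τ (wk s · v₀) (wk t · v₀)
Eq (σ *)   s t =
  con (len σ) · s ≐ con (len σ) · t ∧
  (∀[ 𝟎 ] v₀ <′ con (len σ) · wk s ⇒
    Eq σ (con (at σ) · wk s · v₀) (con (at σ) · wk t · v₀))

_=′_ : Tm S Γ τ → Tm S Γ τ → Fm S Γ
_=′_ {τ = τ} = Eq τ

_∈′_ : Tm S Γ σ → Tm S Γ (σ *) → Fm S Γ
_∈′_ {σ = σ} x s =
  ∃[ 𝟎 ] v₀ <′ con (len σ) · wk s ∧ wk x =′ con (at σ) · wk s · v₀

∀ˢᵗ[_]_ ∃ˢᵗ[_]_ : ∀ τ → Fm S (τ ∷ Γ) → Fm S Γ
∀ˢᵗ[ τ ] A = ∀[ τ ] st v₀ ⇒ A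
∃ˢᵗ[ τ ] A = ∃[ τ ] st v₀ ∧ A

-- Bounded number quantifiers are not primitive here, so they are relativised
-- like the others.  For formulas with standard parameters this makes no
-- difference, as all numbers below a standard number are standard.
infix 35 _ˢᵗ
_ˢᵗ : Fm S Γ → Fm S Γ
(s ≐ t) ˢᵗ    = s ≐ t
(st t) ˢᵗ     = st t
⊥′ ˢᵗ         = ⊥′
(A ∧ B) ˢᵗ    = A ˢᵗ ∧ B ˢᵗ
(A ∨ B) ˢᵗ    = A ˢᵗ ∨ B ˢᵗ
(A ⇒ B) ˢᵗ    = A ˢᵗ ⇒ B ˢᵗ
(∀[ τ ] A) ˢᵗ = ∀ˢᵗ[ τ ] A ˢᵗ
(∃[ τ ] A) ˢᵗ = ∃ˢᵗ[ τ ] A ˢᵗ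

_≈_ : Tm S Γ τ → Tm S Γ τ → Fm S Γ
s ≈ t = (s =′ t) ˢᵗ

Internal : Fm S Γ → Set
Internal (s ≐ t)    = ⊤
Internal (st t)     = ⊥
Internal ⊥′         = ⊤
Internal (A ∧ B)    = Internal A × Internal B
Internal (A ∨ B)    = Internal A × Internal B
Internal (A ⇒ B)    = Internal A × Internal B
Internal (∀[ τ ] A) = Internal A
Internal (∃[ τ ] A) = Internal A

-- Internal and quantifier-free.
QF : Fm S Γ → Set
QF (s ≐ t)    = ⊤
QF (st t)     = ⊥
QF ⊥′         = ⊤
QF (A ∧ B)    = QF A × QF B
QF (A ∨ B)    = QF A × QF B
QF (A ⇒ B)    = QF A × QF B
QF (∀[ τ ] A) = ⊥
QF (∃[ τ ] A) = ⊥

Theory : Sig → Set₁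
Theory S = (Γ : Cxt) → Fm S Γ → Set

-- Axioms may be used in every context of variables and hypotheses.
data _⊢[_]_ {S : Sig} {Γ : Cxt} (H : List (Fm S Γ)) (T : Theory S) : Fm S Γ → Set where
  ax  : ∀ {A} → T Γ A → H ⊢[ T ] A
  hyp : ∀ {A} → A ∈ H → H ⊢[ T ] A
  ⇒I  : ∀ {A B} → A ∷ H ⊢[ T ] B → H ⊢[ T ] A ⇒ B
  ⇒E  : ∀ {A B} → H ⊢[ T ] A ⇒ B → H ⊢[ T ] A → H ⊢[ T ] B
  ∧I  : ∀ {A B} → H ⊢[ T ] A → H ⊢[ T ] B → H ⊢[ T ] A ∧ B
  ∧E₁ : ∀ {A B} → H ⊢[ T ] A ∧ B → H ⊢[ T ] A
  ∧E₂ : ∀ {A B} → H ⊢[ T ] A ∧ B → H ⊢[ T ] B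
  ∨I₁ : ∀ {A B} → H ⊢[ T ] A → H ⊢[ T ] A ∨ B
  ∨I₂ : ∀ {A B} → H ⊢[ T ] B → H ⊢[ T ] A ∨ B
  ∨E  : ∀ {A B C} → H ⊢[ T ] A ∨ B → A ∷ H ⊢[ T ] C → B ∷ H ⊢[ T ] C → H ⊢[ T ] C
  raa : ∀ {A} → ¬′ A ∷ H ⊢[ T ] ⊥′ → H ⊢[ T ] A
  ∀I  : ∀ {τ A} → map wkF H ⊢[ T ] A → H ⊢[ T ] ∀[ τ ] A
  ∀E  : ∀ {τ A} → H ⊢[ T ] ∀[ τ ] A → (t : Tm S Γ τ) → H ⊢[ T ] A [ t ]
  ∃I  : ∀ {τ A} (t : Tm S Γ τ) → H ⊢[ T ] A [ t ] → H ⊢[ T ] ∃[ τ ] A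
  ∃E  : ∀ {τ A C} → H ⊢[ T ] ∃[ τ ] A → A ∷ map wkF H ⊢[ T ] wkF C → H ⊢[ T ] C

_⊢_ : Theory S → Fm S [] → Set
T ⊢ A = [] ⊢[ T ] A

data RCA₀ω {S : Sig} (Γ : Cxt) : Fm S Γ → Set where
  ≐-refl  : ∀ s → RCA₀ω Γ (s ≐ s)
  ≐-sym   : ∀ s t → RCA₀ω Γ (s ≐ t ⇒ t ≐ s)
  ≐-trans : ∀ s t u → RCA₀ω Γ (s ≐ t ⇒ t ≐ u ⇒ s ≐ u)

  ext     : ∀ {ρ τ} (f : Tm S Γ (ρ ⟶ τ)) s t → RCA₀ω Γ (s =′ t ⇒ f · s =′ f · t)

  suc≢0   : ∀ s → RCA₀ω Γ (¬′ suc′ s ≐ O)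
  suc-inj : ∀ s t → RCA₀ω Γ (suc′ s ≐ suc′ t ⇒ s ≐ t)

  Π-eq    : ∀ {ρ τ} (s : Tm S Γ ρ) (t : Tm S Γ τ) →
            RCA₀ω Γ (con (Πᶜ ρ τ) · s · t =′ s)
  Σ-eq    : ∀ {δ ρ τ} (r : Tm S Γ (δ ⟶ ρ ⟶ τ)) (s : Tm S Γ (δ ⟶ ρ)) t →
            RCA₀ω Γ (con (Σᶜ δ ρ τ) · r · s · t =′ r · t · (s · t))

  R₀-zero : ∀ y z → RCA₀ω Γ (con R₀ · O · y · z ≐ y)
  R₀-suc  : ∀ x y z → RCA₀ω Γ (con R₀ · suc′ x · y · z ≐ z · (con R₀ · x · y · z) · x)

  len-tab : ∀ {σ} (f : Tm S Γ (𝟎 ⟶ σ)) n →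
            RCA₀ω Γ (con (len σ) · (con (tab σ) · f · n) ≐ n)
  at-tab  : ∀ {σ} (f : Tm S Γ (𝟎 ⟶ σ)) n i →
            RCA₀ω Γ (i <′ n ⇒ con (at σ) · (con (tab σ) · f · n) · i =′ f · i)

  QF-IA   : (A : Fm S (𝟎 ∷ Γ)) → QF A →
            RCA₀ω Γ (A [ O ] ∧ (∀[ 𝟎 ] A ⇒ sub ((λ x → var (there x)) ▹ suc′ v₀) A)
                     ⇒ (∀[ 𝟎 ] A))

  QF-AC¹⁰ : (A : Fm S (𝟎 ∷ 𝟏 ∷ Γ)) → QF A →
            RCA₀ω Γ ((∀[ 𝟏 ] ∃[ 𝟎 ] A)
                     ⇒ (∃[ 𝟐 ] ∀[ 𝟏 ] sub ((λ x → var (there (there x))) ▹ v₀ ▹ v₁ · v₀) A))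

record Specification : Set where
  field
    ty       : Ty
    D        : Fm ∅ (ty ∷ [])
    internal : Internal D
    unique   : RCA₀ω ⊢ (∀[ ty ] ∀[ ty ] D [ v₁ ]₁ ⇒ D [ v₀ ]₁ ⇒ v₁ =′ v₀)

open Specification public

-- The functional of (∃²), normalised to take values 0 and 1.  Without the
-- second conjunct it would not be unique, as any non-zero value could be taken
-- where g has no zero.
D∃² : Fm ∅ (𝟐 ∷ [])
D∃² = ∀[ 𝟏 ] ((∃[ 𝟎 ] v₁ · v₀ ≐ O) ⇔ v₁ · v₀ ≐ O) ∧ (v₁ · v₀ ≐ O ∨ v₁ · v₀ ≐ suc′ O)

private
  module _ {S : Sig} {Γ : Cxt} {H : List (Fm S Γ)} where

    ≐-trans′ : ∀ {a b c} → H ⊢[ RCA₀ω ] a ≐ b → H ⊢[ RCA₀ω ] b ≐ c → H ⊢[ RCA₀ω ] a ≐ c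
    ≐-trans′ p q = ⇒E (⇒E (ax (≐-trans _ _ _)) p) q

    ≐-sym′ : ∀ {a b} → H ⊢[ RCA₀ω ] a ≐ b → H ⊢[ RCA₀ω ] b ≐ a
    ≐-sym′ p = ⇒E (ax (≐-sym _ _)) p

  agree : ∀ {E : Fm S Γ} {a b} {H} →
    H ⊢[ RCA₀ω ] (E ⇔ a ≐ O) ∧ (a ≐ O ∨ a ≐ suc′ O)
               ⇒ (E ⇔ b ≐ O) ∧ (b ≐ O ∨ b ≐ suc′ O) ⇒ a ≐ b
  agree = ⇒I (⇒I (∨E (∧E₂ (hyp #1))
    (≐-trans′ (hyp #0)
      (≐-sym′ (⇒E (∧E₁ (∧E₁ (hyp #1))) (⇒E (∧E₂ (∧E₁ (hyp #2))) (hyp #0)))))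
    (∨E (∧E₂ (hyp #1))
      (raa (⇒E (ax (suc≢0 O))
        (≐-trans′ (≐-sym′ (hyp #2))
          (⇒E (∧E₁ (∧E₁ (hyp #4))) (⇒E (∧E₂ (∧E₁ (hyp #3))) (hyp #1))))))
      (≐-trans′ (hyp #1) (≐-sym′ (hyp #0))))))
    where
    #0 : ∀ {A : Set} {a : A} {as} → a ∈ a ∷ as
    #0 = here refl
    #1 : ∀ {A : Set} {a b : A} {as} → b ∈ a ∷ b ∷ as
    #1 = there #0
    #2 : ∀ {A : Set} {a b c : A} {as} → c ∈ a ∷ b ∷ c ∷ as
    #2 = there #1
    #3 : ∀ {A : Set} {a b c d : A} {as} → d ∈ a ∷ b ∷ c ∷ d ∷ as
    #3 = there #2
    #4 : ∀ {A : Set} {a b c d e : A} {as} → e ∈ a ∷ b ∷ c ∷ d ∷ e ∷ as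
    #4 = there #3

∃²-functional : Specification
∃²-functional = record
  { ty       = 𝟐
  ; D        = D∃²
  ; internal = ((tt , tt) , (tt , tt)) , (tt , tt)
  ; unique   = ∀I (∀I (⇒I (⇒I (∀I (⇒E (⇒E agree
                 (∀E (hyp (there (here refl))) v₀))
                 (∀E (hyp (here refl)) v₀))))))
  }

-- The theory has a constant Ξ for the functional of (∃²) and for each member of
-- an arbitrary further family of unique specifications.
module _ {I : Set} (spec : I → Specification) where

  spec⁺ : Maybe I → Specification
  spec⁺ nothing  = ∃²-functional
  spec⁺ (just i) = spec i

  sig : Sig
  sig = record { Name = Maybe I ; type = λ i → ty (spec⁺ i) }

  data RCA₀Ω (Γ : Cxt) : Fm sig Γ → Set where
    base     : ∀ {A} → RCA₀ω Γ A → RCA₀Ω Γ A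

    st-resp  : ∀ {τ} (s t : Tm sig Γ τ) → RCA₀Ω Γ (st s ∧ s =′ t ⇒ st t)
    st-term  : ∀ {τ} (t : Tm sig [] τ) → RCA₀Ω Γ (st ⌈ t ⌉)
    st-app   : ∀ {σ τ} (f : Tm sig Γ (σ ⟶ τ)) s → RCA₀Ω Γ (st f ∧ st s ⇒ st (f · s))
    st-below : ∀ m n → RCA₀Ω Γ (st n ∧ m ≤′ n ⇒ st m)

    -- In A, v₀ is z and v₁ is y.
    idealization : ∀ {σ τ} (A : Fm sig (σ ∷ τ ∷ Γ)) → Internal A →
      RCA₀Ω Γ ((∀ˢᵗ[ σ * ] ∃[ τ ] ∀[ σ ] v₀ ∈′ v₂ ⇒ ren (liftR (liftR there)) A)
               ⇒ (∃[ τ ] ∀ˢᵗ[ σ ] A))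

    -- In A, v₀ is y and v₁ is x.
    HAC-int : ∀ {ρ τ} (A : Fm sig (τ ∷ ρ ∷ Γ)) → Internal A →
      RCA₀Ω Γ ((∀ˢᵗ[ ρ ] ∃ˢᵗ[ τ ] A)
               ⇒ (∃ˢᵗ[ ρ ⟶ τ * ] ∀ˢᵗ[ ρ ] ∃[ τ ] v₀ ∈′ v₂ · v₁ ∧ ren (liftR (liftR there)) A))

    PF-TP∀ : ∀ {τ} (A : Fm sig (τ ∷ [])) → Internal A →
      RCA₀Ω Γ ⌈ (∀ˢᵗ[ τ ] A) ⇒ (∀[ τ ] A) ⌉F

    Ξ-spec : ∀ i →
      RCA₀Ω Γ ⌈ st (con (Ξ i)) ∧ (∀ˢᵗ[ ty (spec⁺ i) ] emb (D (spec⁺ i)) ˢᵗ ⇒ con (Ξ i) ≈ v₀) ⌉F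

-- (∃ m) f(m, n) = 0, with f of type 1 applied to the code of a pair.
Σ⁰₁ : Tm S Γ 𝟏 → Tm S Γ 𝟎 → Fm S Γ
Σ⁰₁ f n = ∃[ 𝟎 ] wk f · pair v₀ (wk n) ≐ O

_∈ˢ_ _∉ˢ_ : Tm S Γ 𝟎 → Tm S Γ 𝟏 → Fm S Γ
n ∈ˢ Z = Z · n ≐ suc′ O
n ∉ˢ Z = ¬′ n ∈ˢ Z

isSet : Tm S Γ 𝟏 → Fm S Γ
isSet Z = ∀[ 𝟎 ] wk Z · v₀ ≐ O ∨ wk Z · v₀ ≐ suc′ O

Π⁰₁-TRANS : Fm S []
Π⁰₁-TRANS = ∀ˢᵗ[ 𝟏 ] (∀ˢᵗ[ 𝟎 ] v₁ · v₀ ≐ O) ⇒ (∀[ 𝟎 ] v₁ · v₀ ≐ O)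

Σ⁰₁-SEP* : Fm S []
Σ⁰₁-SEP* =
  ∀ˢᵗ[ 𝟏 ] ∀ˢᵗ[ 𝟏 ]
    (∀ˢᵗ[ 𝟎 ] ¬′ (Σ⁰₁ v₂ v₀ ˢᵗ ∧ Σ⁰₁ v₁ v₀ ˢᵗ))
    ⇒ (∃ˢᵗ[ 𝟏 ] isSet v₀ ∧ (∀[ 𝟎 ] (Σ⁰₁ v₃ v₀ ⇒ v₀ ∉ˢ v₁) ∧ (Σ⁰₁ v₂ v₀ ⇒ v₀ ∈ˢ v₁)))

-- A principle (∃Φ)A(Φ) is given by the type of Φ and the matrix A.
record Principle (S : Sig) : Set where
  constructor exists
  field
    type′  : Ty
    matrix : Fm S (type′ ∷ [])

principle : Principle S → Fm S []
principle (exists τ A) = ∃[ τ ] A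

-- Standard extensionality in each argument (functionals of several arguments
-- are curried).
stExt : ∀ τ → Tm S Γ τ → Fm S Γ
stExt 𝟎       t = ⊤′
stExt (σ *)   t = ⊤′
stExt (ρ ⟶ τ) t =
  (∀ˢᵗ[ ρ ] ∀ˢᵗ[ ρ ] v₁ ≈ v₀ ⇒ wk (wk t) · v₁ ≈ wk (wk t) · v₀)
  ∧ (∀ˢᵗ[ ρ ] stExt τ (wk t · v₀))

E-st : Principle S → Fm S []
E-st (exists τ A) = ∃ˢᵗ[ τ ] A ˢᵗ ∧ stExt τ v₀

∃² : Principle S
∃² = exists 𝟐 (∀[ 𝟏 ] (∃[ 𝟎 ] v₁ · v₀ ≐ O) ⇔ v₁ · v₀ ≐ O)

-- In the matrix, F , f , g are v₂ , v₁ , v₀, shifted under the quantifier over n.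
UΣ⁰₁-SEP : Principle S
UΣ⁰₁-SEP = exists (𝟏 ⟶ 𝟏 ⟶ 𝟎 ⟶ 𝟎)
  (∀[ 𝟏 ] ∀[ 𝟏 ]
    (∀[ 𝟎 ] ¬′ (Σ⁰₁ v₂ v₀ ∧ Σ⁰₁ v₁ v₀))
    ⇒ (∀[ 𝟎 ] Σ⁰₁ v₂ v₀ ⇒ v₃ · v₂ · v₁ · v₀ ≐ suc′ O)
      ∧ (∀[ 𝟎 ] Σ⁰₁ v₁ v₀ ⇒ v₃ · v₂ · v₁ · v₀ ≐ O))

{-# OPTIONS --safe #-}

-- All four principles are equivalent to Σ⁰₁-reflection: a standard g with a zero
-- has a standard zero.
--
-- For (∃²)ˢᵗ from reflection, HAC-int yields a standard Φ such that Φ(g) lists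
-- candidates for a zero of g, and these can be searched.  Conversely, (∃²)ˢᵗ makes
-- the constant Ξ₀ decide standard zeros; as Ξ₀ does not count as a parameter,
-- PF-TP∀ makes it decide zeros of all g, so that reflection follows, and
-- { n | Ξ₀(λ m. f₂(m, n)) = 0 } separates as Σ⁰₁-SEP* requires.
--
-- If reflection fails for g, then  f(m, n) = 0 ⇔ g has a zero ≤ (m, n)
-- defines a Σ⁰₁ formula which is false in the standard sense and true internally,
-- and Σ⁰₁-SEP* for f₁ = f₂ = f is contradictory.
--
-- Given a standard extensional F as in UΣ⁰₁-SEP, let f be as above, but with
-- values 0 and 1, and let 1 be the constant function.  If g has no standard zero,
-- then f ≈ 1, and F(f, 1, 0) and F(1, f, 0) both equal F(1, 1, 0).  Otherwise they
-- are 1 and 0.  So one of them, depending on whether F(1, 1, 0) = 0, decides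
-- whether g has a standard zero.

module Submission where

open import Defs
open import Data.List.Base using (List; []; _∷_; map)
open import Data.List.Membership.Propositional using (_∈_)
open import Data.List.Relation.Unary.Any using (here; there)
open import Data.Maybe.Base using (Maybe; just; nothing; zipWith)
open import Data.Product.Base using (_×_; _,_)
open import Data.Unit.Base using (tt)
open import Relation.Binary.PropositionalEquality
  using (_≡_; refl; sym; trans; cong; cong₂)

private
  variable
    S     : Sig
    Γ Δ Θ : Cxt
    ρ σ τ : Ty

-- Renaming and substitution

subTm-ren : (s : Sub S Δ Θ) (r : Ren Γ Δ) (t : Tm S Γ τ) →
  subTm s (renTm r t) ≡ subTm (λ x → s (r x)) t
subTm-ren s r (var x) = refl
subTm-ren s r (con c) = refl
subTm-ren s r (t · u) = cong₂ _·_ (subTm-ren s r t) (subTm-ren s r u)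

subTm-var : (t : Tm S Γ τ) → subTm var t ≡ t
subTm-var (var x) = refl
subTm-var (con c) = refl
subTm-var (t · u) = cong₂ _·_ (subTm-var t) (subTm-var u)

▹-wk : (s : Sub S Γ Δ) (a : Tm S Δ σ) (t : Tm S Γ τ) → subTm (s ▹ a) (wk t) ≡ subTm s t
▹-wk s a = subTm-ren (s ▹ a) there

instantiate-wk : (a : Tm S Γ σ) (t : Tm S Γ τ) → subTm (var ▹ a) (wk t) ≡ t
instantiate-wk a t = trans (▹-wk var a t) (subTm-var t)

renTm-wk : (r : Ren Γ Δ) (t : Tm S Γ τ) →
  renTm (liftR {σ = σ} r) (wk t) ≡ wk (renTm r t)
renTm-wk r (var x) = refl
renTm-wk r (con c) = refl
renTm-wk r (t · u) = cong₂ _·_ (renTm-wk r t) (renTm-wk r u)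

subTm-wk : (s : Sub S Γ Δ) (t : Tm S Γ τ) →
  subTm (liftS {σ = σ} s) (wk t) ≡ wk (subTm s t)
subTm-wk s (var x) = refl
subTm-wk s (con c) = refl
subTm-wk s (t · u) = cong₂ _·_ (subTm-wk s t) (subTm-wk s u)

ren-<′ : (r : Ren Γ Δ) (a b : Tm S Γ 𝟎) → ren r (a <′ b) ≡ renTm r a <′ renTm r b
ren-<′ r a b =
  cong₂ (λ a b → ∃[ 𝟎 ] v₀ +′ (con Sᶜ · a) ≐ b) (renTm-wk r a) (renTm-wk r b)

sub-<′ : (s : Sub S Γ Δ) (a b : Tm S Γ 𝟎) → sub s (a <′ b) ≡ subTm s a <′ subTm s b
sub-<′ s a b =
  cong₂ (λ a b → ∃[ 𝟎 ] v₀ +′ (con Sᶜ · a) ≐ b) (subTm-wk s a) (subTm-wk s b)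

ren-Eq : ∀ τ (r : Ren Γ Δ) (a b : Tm S Γ τ) → ren r (Eq τ a b) ≡ Eq τ (renTm r a) (renTm r b)
ren-Eq 𝟎       r a b = refl
ren-Eq (ρ ⟶ τ) r a b = cong (∀[ ρ ]_) (trans (ren-Eq τ (liftR r) _ _)
  (cong₂ (λ a b → Eq τ (a · v₀) (b · v₀)) (renTm-wk r a) (renTm-wk r b)))
ren-Eq (σ *)   r a b = cong₂ _∧_ refl (cong (∀[ 𝟎 ]_) (cong₂ _⇒_
  (trans (ren-<′ (liftR r) v₀ (con (len σ) · wk a)) (cong (λ a → v₀ <′ con (len σ) · a) (renTm-wk r a)))
  (trans (ren-Eq σ (liftR r) _ _)
    (cong₂ (λ a b → Eq σ (con (at σ) · a · v₀) (con (at σ) · b · v₀))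
      (renTm-wk r a) (renTm-wk r b)))))

sub-Eq : ∀ τ (s : Sub S Γ Δ) (a b : Tm S Γ τ) → sub s (Eq τ a b) ≡ Eq τ (subTm s a) (subTm s b)
sub-Eq 𝟎       s a b = refl
sub-Eq (ρ ⟶ τ) s a b = cong (∀[ ρ ]_) (trans (sub-Eq τ (liftS s) _ _)
  (cong₂ (λ a b → Eq τ (a · v₀) (b · v₀)) (subTm-wk s a) (subTm-wk s b)))
sub-Eq (σ *)   s a b = cong₂ _∧_ refl (cong (∀[ 𝟎 ]_) (cong₂ _⇒_
  (trans (sub-<′ (liftS s) v₀ (con (len σ) · wk a)) (cong (λ a → v₀ <′ con (len σ) · a) (subTm-wk s a)))
  (trans (sub-Eq σ (liftS s) _ _)
    (cong₂ (λ a b → Eq σ (con (at σ) · a · v₀) (con (at σ) · b · v₀))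
      (subTm-wk s a) (subTm-wk s b)))))

-- Abstraction

strengthen : Tm S (σ ∷ Γ) τ → Maybe (Tm S Γ τ)
strengthen (var (here _))  = nothing
strengthen (var (there x)) = just (var x)
strengthen (con c)         = just (con c)
strengthen (t · u)         = zipWith _·_ (strengthen t) (strengthen u)

strengthen-sound : (t : Tm S (σ ∷ Γ) τ) {t′ : Tm S Γ τ} → strengthen t ≡ just t′ → t ≡ wk t′
strengthen-sound (var (there x)) refl = refl
strengthen-sound (con c)         refl = refl
strengthen-sound (t · u) eq with strengthen t in p | strengthen u in q
strengthen-sound (t · u) refl | just t′ | just u′ =
  cong₂ _·_ (strengthen-sound t p) (strengthen-sound u q)

-- Unlike ƛ, this leaves subterms without the abstracted variable intact, as
-- iterating ƛ over nested closed terms makes them exponentially large.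
lam : Tm S (σ ∷ Γ) τ → Tm S Γ (σ ⟶ τ)
lam-app : Tm S (σ ∷ Γ) (ρ ⟶ τ) → Tm S (σ ∷ Γ) ρ → Maybe (Tm S Γ τ) → Tm S Γ (σ ⟶ τ)
lam (var x) = ƛ (var x)
lam (con c) = ƛ (con c)
lam (t · u) = lam-app t u (strengthen (t · u))
lam-app t u (just t′) = con (Πᶜ _ _) · t′
lam-app t u nothing   = con (Σᶜ _ _ _) · lam t · lam u

-- Functionals written as combinator terms

cond : Tm S Γ 𝟎 → Tm S Γ 𝟎 → Tm S Γ 𝟎 → Tm S Γ 𝟎
-- The step of the recursion is constantly `b`, so zero selects `a` and every successor selects `b`.
-- Throughout, the value 0 stands for truth.
cond n a b = con R₀ · n · a · (con (Πᶜ (𝟎 ⟶ 𝟎) 𝟎) · (con (Πᶜ 𝟎 𝟎) · b))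

𝟙 : Tm S Γ 𝟎
𝟙 = suc′ O

walk-step : Tm S Γ (𝟏 ⟶ 𝟎 ⟶ 𝟎 ⟶ 𝟎)
-- `v₂` is g, `v₁` the position so far and `v₀` the index, in the order in which `R₀` passes value
-- and index. A zero is never left.
walk-step = lam (lam (lam (cond (v₂ · v₁) v₁ (suc′ v₀))))

-- walk g k is the least zero of g below k, or k if there is none.
walk : Tm S Γ (𝟏 ⟶ 𝟎 ⟶ 𝟎)
walk = lam (lam (con R₀ · v₀ · O · (walk-step · v₁)))

negate : Tm S Γ (𝟏 ⟶ 𝟎 ⟶ 𝟎)
negate = lam (lam (cond (v₁ · v₀) 𝟙 O))

normalize : Tm S Γ (𝟐 ⟶ 𝟐)
normalize = lam (lam (cond (v₁ · v₀) O 𝟙))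

tail : Tm S Γ (𝟏 ⟶ 𝟏)
tail = lam (lam (v₁ · suc′ v₀))

cons : Tm S Γ (𝟎 ⟶ 𝟏 ⟶ 𝟏)
cons = lam (lam (lam (con R₀ · v₀ · v₂ · (con (Πᶜ 𝟏 𝟎) · v₁))))

section : Tm S Γ (𝟏 ⟶ 𝟎 ⟶ 𝟏)
section = lam (lam (lam (v₂ · pair v₀ v₁)))

separator : Tm S Γ (𝟐 ⟶ 𝟏 ⟶ 𝟏)
separator = lam (lam (lam (cond (v₂ · (section · v₁ · v₀)) 𝟙 O)))

-- The code of a pair bounds its first component, so that  λ m. found g (pair m n)
-- has a zero for every n as soon as g has one.
found : Tm S Γ (𝟏 ⟶ 𝟏)
found = lam (lam (v₁ · (walk · v₁ · v₀)))

along : Tm S Γ ((𝟏 ⟶ 𝟎 *) ⟶ 𝟏 ⟶ 𝟏)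
along = lam (lam (lam (v₁ · (con (at 𝟎) · (v₂ · v₁) · v₀))))

-- If no candidate is a zero, g is evaluated at the unspecified entry just past the end of `Φ · g`.
search : Tm S Γ ((𝟏 ⟶ 𝟎 *) ⟶ 𝟐)
search = lam (lam (found · (along · v₁ · v₀) · (con (len 𝟎) · (v₁ · v₀))))

uniform-separator : Tm S Γ (𝟐 ⟶ 𝟏 ⟶ 𝟏 ⟶ 𝟎 ⟶ 𝟎)
uniform-separator = lam (lam (lam (separator · v₂ · v₁)))

one : Tm S Γ 𝟏
one = con (Πᶜ 𝟎 𝟎) · 𝟙

found-sign : Tm S Γ (𝟏 ⟶ 𝟏)
found-sign = lam (lam (cond (found · v₁ · v₀) O 𝟙))

test-left test-right : Tm S Γ ((𝟏 ⟶ 𝟏 ⟶ 𝟎 ⟶ 𝟎) ⟶ 𝟐)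
test-left  = lam (lam (cond (v₁ · (found-sign · v₀) · one · O) 𝟙 O))
test-right = lam (lam (v₁ · one · (found-sign · v₀) · O))

Σ⁰₁-REFLECTION : Fm S Γ
Σ⁰₁-REFLECTION = ∀ˢᵗ[ 𝟏 ] (∃[ 𝟎 ] v₁ · v₀ ≐ O) ⇒ (∃ˢᵗ[ 𝟎 ] v₁ · v₀ ≐ O)

module Derivations {I : Set} (spec : I → Specification) where

  private
    L : Sig
    L = sig spec

    T : Theory L
    T = RCA₀Ω spec

    variable
      H                 : List (Fm L Γ)
      A B C A₃ A₄ A₅ A₆ : Fm L Γ

  -- Natural deduction shorthands

  h₀ : A ∷ H ⊢[ T ] A
  h₀ = hyp (here refl)
  h₁ : A ∷ B ∷ H ⊢[ T ] B
  h₁ = hyp (there (here refl))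
  h₂ : A ∷ B ∷ C ∷ H ⊢[ T ] C
  h₂ = hyp (there (there (here refl)))
  h₃ : A ∷ B ∷ C ∷ A₃ ∷ H ⊢[ T ] A₃
  h₃ = hyp (there (there (there (here refl))))
  h₄ : A ∷ B ∷ C ∷ A₃ ∷ A₄ ∷ H ⊢[ T ] A₄
  h₄ = hyp (there (there (there (there (here refl)))))
  h₅ : A ∷ B ∷ C ∷ A₃ ∷ A₄ ∷ A₅ ∷ H ⊢[ T ] A₅
  h₅ = hyp (there (there (there (there (there (here refl))))))
  h₆ : A ∷ B ∷ C ∷ A₃ ∷ A₄ ∷ A₅ ∷ A₆ ∷ H ⊢[ T ] A₆
  h₆ = hyp (there (there (there (there (there (there (here refl)))))))

  cast : A ≡ B → H ⊢[ T ] A → H ⊢[ T ] B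
  cast refl d = d

  ⊥E : H ⊢[ T ] ⊥′ → H ⊢[ T ] A
  ⊥E d = ⇒E (⇒I (raa h₁)) d

  em : ∀ A → H ⊢[ T ] A ∨ ¬′ A
  em A = raa (⇒E h₀ (∨I₂ (⇒I (⇒E h₁ (∨I₁ h₀)))))

  ∀ˢᵗI : {A : Fm L (τ ∷ Γ)} → st v₀ ∷ map wkF H ⊢[ T ] A → H ⊢[ T ] ∀ˢᵗ[ τ ] A
  ∀ˢᵗI d = ∀I (⇒I d)

  ∀ˢᵗE : {A : Fm L (τ ∷ Γ)} → H ⊢[ T ] ∀ˢᵗ[ τ ] A → (t : Tm L Γ τ) → H ⊢[ T ] st t → H ⊢[ T ] A [ t ]
  ∀ˢᵗE d t e = ⇒E (∀E d t) e

  ∃ˢᵗI : {A : Fm L (τ ∷ Γ)} (t : Tm L Γ τ) → H ⊢[ T ] st t → H ⊢[ T ] A [ t ] → H ⊢[ T ] ∃ˢᵗ[ τ ] A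
  ∃ˢᵗI t d e = ∃I t (∧I d e)

  -- Equality

  ≐r : (a : Tm L Γ 𝟎) → H ⊢[ T ] a ≐ a
  ≐r a = ax (base (≐-refl a))

  ≐s : {a b : Tm L Γ 𝟎} → H ⊢[ T ] a ≐ b → H ⊢[ T ] b ≐ a
  ≐s p = ⇒E (ax (base (≐-sym _ _))) p

  infixr 5 _∙_
  _∙_ : {a b c : Tm L Γ 𝟎} → H ⊢[ T ] a ≐ b → H ⊢[ T ] b ≐ c → H ⊢[ T ] a ≐ c
  p ∙ q = ⇒E (⇒E (ax (base (≐-trans _ _ _))) p) q

  Eq-app : (f g : Tm L Γ (ρ ⟶ τ)) (a : Tm L Γ ρ) → H ⊢[ T ] Eq (ρ ⟶ τ) f g → H ⊢[ T ] Eq τ (f · a) (g · a)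
  Eq-app {τ = τ} f g a d = cast (trans (sub-Eq τ (var ▹ a) _ _)
    (cong₂ (λ f g → Eq τ (f · a) (g · a)) (instantiate-wk a f) (instantiate-wk a g)))
    (∀E d a)

  Eq-at : (s t : Tm L Γ (σ *)) (i : Tm L Γ 𝟎) → H ⊢[ T ] Eq (σ *) s t → H ⊢[ T ] i <′ con (len σ) · s →
    H ⊢[ T ] Eq σ (con (at σ) · s · i) (con (at σ) · t · i)
  Eq-at {σ = σ} s t i d e = ⇒E (cast (cong₂ _⇒_
    (trans (sub-<′ (var ▹ i) v₀ (con (len σ) · wk s)) (cong (λ s → i <′ con (len σ) · s) (instantiate-wk i s)))
    (trans (sub-Eq σ (var ▹ i) _ _)
      (cong₂ (λ s t → Eq σ (con (at σ) · s · i) (con (at σ) · t · i))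
        (instantiate-wk i s) (instantiate-wk i t))))
    (∀E (∧E₂ d) i)) e

  <′-resp : (i a b : Tm L Γ 𝟎) → H ⊢[ T ] a ≐ b ⇒ i <′ a ⇒ i <′ b
  <′-resp i a b = ⇒I (⇒I (∃E h₀ (∃I v₀ (cast
    (cong₂ (λ i b → v₀ +′ (con Sᶜ · i) ≐ b) (sym (shift i)) (sym (shift b)))
    (h₀ ∙ h₂)))))
    where
    shift : (t : Tm L _ 𝟎) → subTm (var ▹ v₀) (renTm (liftR there) (wk t)) ≡ wk t
    shift t = trans (cong (subTm (var ▹ v₀)) (renTm-wk there t)) (instantiate-wk v₀ (wk t))

  Eq-refl : ∀ τ (a : Tm L Γ τ) → H ⊢[ T ] Eq τ a a
  Eq-refl 𝟎       a = ≐r a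
  Eq-refl (ρ ⟶ τ) a = ∀I (Eq-refl τ _)
  Eq-refl (σ *)   a = ∧I (≐r _) (∀I (⇒I (Eq-refl σ _)))

  wk-Eq : {a b : Tm L Γ τ} → H ⊢[ T ] wkF {σ = σ} (Eq τ a b) → H ⊢[ T ] Eq τ (wk a) (wk b)
  wk-Eq {τ = τ} = cast (ren-Eq τ there _ _)

  -- With reflexivity this yields symmetry and transitivity from a single induction on the type. For
  -- sequences both hypotheses are bounded by the length of `a`, so the bound on the index is moved
  -- only from `b` to `a`.
  Eq-euclidean : ∀ τ (a b c : Tm L Γ τ) → H ⊢[ T ] Eq τ a b ⇒ Eq τ a c ⇒ Eq τ b c
  Eq-euclidean 𝟎       a b c = ⇒I (⇒I (≐s h₁ ∙ h₀))
  Eq-euclidean (ρ ⟶ τ) a b c = ⇒I (⇒I (∀I (⇒E (⇒E (Eq-euclidean τ _ _ _)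
    (Eq-app _ _ v₀ (wk-Eq {τ = ρ ⟶ τ} h₁))) (Eq-app _ _ v₀ (wk-Eq {τ = ρ ⟶ τ} h₀)))))
  Eq-euclidean (σ *)   a b c = ⇒I (⇒I (∧I (≐s (∧E₁ h₁) ∙ ∧E₁ h₀) (∀I (⇒I (⇒E (⇒E (Eq-euclidean σ _ _ _)
    (Eq-at _ _ v₀ (wk-Eq {τ = σ *} h₂) (below-a (≐s (∧E₁ h₂)))))
    (Eq-at _ _ v₀ (wk-Eq {τ = σ *} h₁) (below-a (≐s (∧E₁ h₂)))))))))
    where
    below-a : ∀ {H} {i x y : Tm L _ 𝟎} → i <′ x ∷ H ⊢[ T ] x ≐ y → i <′ x ∷ H ⊢[ T ] i <′ y
    below-a p = ⇒E (⇒E (<′-resp _ _ _) p) h₀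

  Eq-sym : {a b : Tm L Γ τ} → H ⊢[ T ] Eq τ a b → H ⊢[ T ] Eq τ b a
  Eq-sym {τ = τ} p = ⇒E (⇒E (Eq-euclidean τ _ _ _) p) (Eq-refl τ _)

  Eq-trans : {a b c : Tm L Γ τ} → H ⊢[ T ] Eq τ a b → H ⊢[ T ] Eq τ b c → H ⊢[ T ] Eq τ a c
  Eq-trans {τ = τ} p q = ⇒E (⇒E (Eq-euclidean τ _ _ _) (Eq-sym {τ = τ} p)) q

  Eq-ext : (f : Tm L Γ (ρ ⟶ τ)) {a b : Tm L Γ ρ} → H ⊢[ T ] Eq ρ a b → H ⊢[ T ] Eq τ (f · a) (f · b)
  Eq-ext f p = ⇒E (ax (base (ext f _ _))) p

  -- The substitution `s` collects the arguments already passed, so nested abstractions can be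
  -- reduced without commuting substitution with abstraction.
  βƛ : ∀ {Γ Δ σ τ} {H : List (Fm L Δ)} (s : Sub L Γ Δ) (t : Tm L (σ ∷ Γ) τ) (a : Tm L Δ σ) →
    H ⊢[ T ] Eq τ (subTm s (ƛ t) · a) (subTm (s ▹ a) t)
  βƛ {σ = σ} s (var (here refl)) a =
    Eq-trans {τ = σ} (ax (base (Σ-eq (con (Πᶜ σ (σ ⟶ σ))) (con (Πᶜ σ σ)) a)))
      (ax (base (Π-eq a (con (Πᶜ σ σ) · a))))
  βƛ s (var (there x)) a = ax (base (Π-eq (s x) a))
  βƛ s (con c) a = ax (base (Π-eq (con c) a))
  βƛ {τ = τ} s (t · u) a = Eq-trans {τ = τ} (ax (base (Σ-eq _ _ a)))
    (Eq-trans {τ = τ} (Eq-app {τ = τ} _ _ _ (βƛ s t a)) (Eq-ext _ (βƛ s u a)))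

  β : ∀ {Γ Δ σ τ} {H : List (Fm L Δ)} (s : Sub L Γ Δ) (t : Tm L (σ ∷ Γ) τ) (a : Tm L Δ σ) →
    H ⊢[ T ] Eq τ (subTm s (lam t) · a) (subTm (s ▹ a) t)
  β s (var x) a = βƛ s (var x) a
  β s (con c) a = βƛ s (con c) a
  β {σ = σ} {τ} s (t · u) a with strengthen (t · u) in eq
  ... | just t′ = cast (cong (Eq τ (con (Πᶜ τ σ) · subTm s t′ · a))
        (sym (trans (cong (subTm (s ▹ a)) (strengthen-sound (t · u) eq)) (▹-wk s a t′))))
        (ax (base (Π-eq (subTm s t′) a)))
  ... | nothing = Eq-trans {τ = τ} (ax (base (Σ-eq _ _ a)))
        (Eq-trans {τ = τ} (Eq-app {τ = τ} _ _ _ (β s t a)) (Eq-ext _ (β s u a)))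

  β₂ : ∀ {Γ Δ ρ σ τ} {H : List (Fm L Δ)} (s : Sub L Γ Δ) (t : Tm L (σ ∷ ρ ∷ Γ) τ) a b →
    H ⊢[ T ] Eq τ (subTm s (lam (lam t)) · a · b) (subTm (s ▹ a ▹ b) t)
  β₂ {τ = τ} s t a b =
    Eq-trans {τ = τ} (Eq-app {τ = τ} _ _ b (β s (lam t) a)) (β (s ▹ a) t b)

  β₃ : ∀ {Γ Δ υ ρ σ τ} {H : List (Fm L Δ)} (s : Sub L Γ Δ) (t : Tm L (σ ∷ ρ ∷ υ ∷ Γ) τ) a b c →
    H ⊢[ T ] Eq τ (subTm s (lam (lam (lam t))) · a · b · c) (subTm (s ▹ a ▹ b ▹ c) t)
  β₃ {τ = τ} s t a b c =
    Eq-trans {τ = τ} (Eq-app {τ = τ} _ _ c (β₂ s (lam t) a b)) (β (s ▹ a ▹ b) t c)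

  -- Arithmetic

  induction : (A : Fm L (𝟎 ∷ Γ)) → QF A → H ⊢[ T ] A [ O ] →
    A ∷ map wkF H ⊢[ T ] sub ((λ x → var (there x)) ▹ suc′ v₀) A → (n : Tm L Γ 𝟎) → H ⊢[ T ] A [ n ]
  induction A qf z s n = ∀E (⇒E (ax (base (QF-IA A qf))) (∧I z (∀I (⇒I s)))) n

  cond-suc : ∀ {Γ H} {n a b : Tm L Γ 𝟎} → H ⊢[ T ] cond (suc′ n) a b ≐ b
  cond-suc {n = n} {a} {b} = ax (base (R₀-suc n a _))
    ∙ Eq-app {τ = 𝟎} _ _ n (ax (base (Π-eq (con (Πᶜ 𝟎 𝟎) · b) (cond n a b)))) ∙ ax (base (Π-eq b n))

  cond-zero : ∀ {Γ H} {n a b : Tm L Γ 𝟎} → H ⊢[ T ] n ≐ O → H ⊢[ T ] cond n a b ≐ a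
  cond-zero {a = a} p = Eq-app {τ = 𝟎} _ _ _
    (Eq-app {τ = (𝟎 ⟶ 𝟎 ⟶ 𝟎) ⟶ 𝟎} _ _ a (Eq-ext {τ = 𝟎 ⟶ (𝟎 ⟶ 𝟎 ⟶ 𝟎) ⟶ 𝟎} (con R₀) p))
    ∙ ax (base (R₀-zero a _))

  -- `R₀` computes only on numerals of the form `suc′ n`; induction on `n` supplies that case
  -- distinction.
  cond-pos : ∀ {Γ H} {n a b : Tm L Γ 𝟎} → H ⊢[ T ] ¬′ n ≐ O → H ⊢[ T ] cond n a b ≐ b
  cond-pos {n = n} {a} {b} p = ⇒E
    (cast (cong₂ (λ a b → ¬′ n ≐ O ⇒ cond n a b ≐ b) (instantiate-wk n a) (instantiate-wk n b))
      (induction (¬′ v₀ ≐ O ⇒ cond v₀ (wk a) (wk b) ≐ wk b) ((tt , tt) , tt)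
        (⇒I (⊥E (⇒E h₀ (≐r O)))) (⇒I cond-suc) n))
    p

  +′-suc : ∀ {Γ H} {m n : Tm L Γ 𝟎} → H ⊢[ T ] suc′ m +′ n ≐ suc′ (m +′ n)
  +′-suc {m = m} {n} = ax (base (R₀-suc m n _))
    ∙ Eq-app {τ = 𝟎} _ _ m (βƛ var (ƛ (suc′ v₁)) (m +′ n)) ∙ βƛ (var ▹ (m +′ n)) (suc′ v₁) m

  walk-zero : ∀ {Γ H} {g : Tm L Γ 𝟏} → H ⊢[ T ] walk · g · O ≐ O
  walk-zero {g = g} =
    β₂ var (con R₀ · v₀ · O · (walk-step · v₁)) g O ∙ ax (base (R₀-zero O _))

  walk-suc : ∀ {Γ H} {g : Tm L Γ 𝟏} {k} →
    H ⊢[ T ] walk · g · suc′ k ≐ cond (g · (walk · g · k)) (walk · g · k) (suc′ k)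
  walk-suc {g = g} {k} = β₂ var body g (suc′ k) ∙ ax (base (R₀-suc k O _))
    -- The recursor at `k` is folded back into `walk · g · k`.
    ∙ Eq-app {τ = 𝟎} _ _ k (Eq-ext {τ = 𝟏} (walk-step · g) (≐s (β₂ var body g k)))
    ∙ β₃ var (cond (v₂ · v₁) v₁ (suc′ v₀)) g (walk · g · k) k
    where
    body : ∀ {Γ} → Tm L (𝟎 ∷ 𝟏 ∷ Γ) 𝟎
    body = con R₀ · v₀ · O · (walk-step · v₁)

  walk-stays : ∀ {Γ H} {g : Tm L Γ 𝟏} {k} → H ⊢[ T ] g · (walk · g · k) ≐ O →
    H ⊢[ T ] g · (walk · g · suc′ k) ≐ O
  walk-stays {g = g} p = Eq-ext g (walk-suc ∙ cond-zero p) ∙ p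

  -- From a non-zero of g the walk always moves on to the current bound. With g quantified inside
  -- the formula it is a variable, on which substitutions compute without casts.
  walk-found-or-at-end : ∀ {Γ} {H : List (Fm L Γ)} →
    H ⊢[ T ] ∀[ 𝟏 ] ∀[ 𝟎 ] v₁ · (walk · v₁ · v₀) ≐ O ∨ walk · v₁ · v₀ ≐ v₀
  walk-found-or-at-end = ∀I (∀I (induction (v₂ · (walk · v₂ · v₀) ≐ O ∨ walk · v₂ · v₀ ≐ v₀)
    (tt , tt) (∨I₂ walk-zero)
    (∨E (em (v₂ · (walk · v₂ · v₀) ≐ O))
      (∨I₁ (walk-stays h₀))
      (∨I₂ (walk-suc ∙ cond-pos h₀)))
    v₀))

  -- The induction is on the number added, which stands on the left because `_+′_` recurses on its
  -- first argument.
  walk-persists : ∀ {Γ} {H : List (Fm L Γ)} →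
    H ⊢[ T ] ∀[ 𝟏 ] ∀[ 𝟎 ] ∀[ 𝟎 ] v₂ · (walk · v₂ · v₁) ≐ O ⇒ v₂ · (walk · v₂ · (v₀ +′ v₁)) ≐ O
  walk-persists = ∀I (∀I (∀I (induction
    (v₃ · (walk · v₃ · v₂) ≐ O ⇒ v₃ · (walk · v₃ · (v₀ +′ v₂)) ≐ O) (tt , tt)
    (⇒I (Eq-ext _ (Eq-ext _ (ax (base (R₀-zero _ _)))) ∙ h₀))
    (⇒I (Eq-ext _ (Eq-ext _ +′-suc) ∙ walk-stays (⇒E h₁ h₀)))
    v₀)))

  walk-hits : ∀ {Γ} {H : List (Fm L Γ)} →
    H ⊢[ T ] ∀[ 𝟏 ] ∀[ 𝟎 ] v₁ · v₀ ≐ O ⇒ v₁ · (walk · v₁ · v₀) ≐ O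
  walk-hits = ∀I (∀I (⇒I (∨E (∀E (∀E walk-found-or-at-end v₁) v₀)
    h₀ (Eq-ext v₁ h₀ ∙ h₁))))

  1≢0 : H ⊢[ T ] 𝟙 ≐ O → H ⊢[ T ] A
  1≢0 p = ⊥E (⇒E (ax (base (suc≢0 O))) p)

  cond-0-1 : ∀ {Γ H} {n : Tm L Γ 𝟎} → H ⊢[ T ] cond n O 𝟙 ≐ O ⇒ n ≐ O
  cond-0-1 = ⇒I (raa (1≢0 (≐s (cond-pos h₀) ∙ h₁)))

  cond-1-0 : ∀ {Γ H} {n : Tm L Γ 𝟎} → H ⊢[ T ] cond n 𝟙 O ≐ 𝟙 ⇒ n ≐ O
  cond-1-0 = ⇒I (raa (1≢0 (≐s h₁ ∙ cond-pos h₀)))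

  negate-eq : ∀ {Γ H} (g : Tm L Γ 𝟏) n → H ⊢[ T ] negate · g · n ≐ cond (g · n) 𝟙 O
  negate-eq g n = β₂ var (cond (v₁ · v₀) 𝟙 O) g n

  normalize-eq : ∀ {Γ H} (φ : Tm L Γ 𝟐) g → H ⊢[ T ] normalize · φ · g ≐ cond (φ · g) O 𝟙
  normalize-eq φ g = β₂ var (cond (v₁ · v₀) O 𝟙) φ g

  section-eq : ∀ {Γ H} (f : Tm L Γ 𝟏) n m → H ⊢[ T ] section · f · n · m ≐ f · pair m n
  section-eq f n m = β₃ var (v₂ · pair v₀ v₁) f n m

  separator-eq : ∀ {Γ H} (φ : Tm L Γ 𝟐) f n →
    H ⊢[ T ] separator · φ · f · n ≐ cond (φ · (section · f · n)) 𝟙 O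
  separator-eq φ f n = β₃ var (cond (v₂ · (section · v₁ · v₀)) 𝟙 O) φ f n

  found-eq : ∀ {Γ H} (g : Tm L Γ 𝟏) k → H ⊢[ T ] found · g · k ≐ g · (walk · g · k)
  found-eq g k = β₂ var (v₁ · (walk · v₁ · v₀)) g k

  -- Standardness

  st-closed : (t : Tm L [] τ) → H ⊢[ T ] st ⌈ t ⌉
  st-closed t = ax (st-term t)

  infixl 6 _·ˢ_
  _·ˢ_ : {f : Tm L Γ (σ ⟶ τ)} {a : Tm L Γ σ} → H ⊢[ T ] st f → H ⊢[ T ] st a → H ⊢[ T ] st (f · a)
  p ·ˢ q = ⇒E (ax (st-app _ _)) (∧I p q)

  st-+′ : {m n : Tm L Γ 𝟎} → H ⊢[ T ] st m → H ⊢[ T ] st n → H ⊢[ T ] st (m +′ n)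
  st-+′ p q = st-closed (con R₀) ·ˢ p ·ˢ q ·ˢ st-closed (ƛ (ƛ (suc′ v₁)))

  st-pair : {m n : Tm L Γ 𝟎} → H ⊢[ T ] st m → H ⊢[ T ] st n → H ⊢[ T ] st (pair m n)
  st-pair p q = st-+′ (st-closed (con R₀) ·ˢ st-+′ p q ·ˢ st-closed O
    ·ˢ st-closed (ƛ (ƛ (suc′ v₀ +′ v₁)))) p

  -- Σ⁰₁-reflection

  -- Transfer and reflection are contrapositives of each other, with `negate` exchanging zeros and
  -- non-zeros.
  TRANS⇒reflection : H ⊢[ T ] Π⁰₁-TRANS ⇒ Σ⁰₁-REFLECTION
  TRANS⇒reflection = ⇒I (∀ˢᵗI (⇒I (raa (∃E h₁ (⇒E
    (⇒I (1≢0 (≐s (negate-eq v₁ v₀ ∙ cond-zero h₁) ∙ ∀E h₀ v₀)))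
    (⇒E (∀ˢᵗE h₄ (negate · v₁) (st-closed negate ·ˢ h₃))
      (∀ˢᵗI (negate-eq v₂ v₀ ∙ cond-pos (⇒I (⇒E h₃ (∃ˢᵗI v₀ h₁ h₀)))))))))))

  reflection⇒TRANS : H ⊢[ T ] Σ⁰₁-REFLECTION ⇒ Π⁰₁-TRANS
  reflection⇒TRANS = ⇒I (∀ˢᵗI (⇒I (∀I (raa (∃E
    (⇒E (∀ˢᵗE h₃ (negate · v₁) (st-closed negate ·ˢ h₂))
      (∃I v₀ (negate-eq v₁ v₀ ∙ cond-pos h₀)))
    (1≢0 (≐s (negate-eq v₂ v₀ ∙ cond-zero (∀ˢᵗE h₂ v₀ (∧E₁ h₀))) ∙ ∧E₂ h₀)))))))

  -- The code of (n, 0) is a triangular number plus n: the walk is on a zero by stage n, and the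
  -- triangular number is the amount over which it persists.
  found-at-pair : ∀ {Γ} {H : List (Fm L Γ)} →
    H ⊢[ T ] ∀[ 𝟏 ] ∀[ 𝟎 ] v₁ · v₀ ≐ O ⇒ found · v₁ · pair v₀ O ≐ O
  found-at-pair = ∀I (∀I (⇒I (found-eq v₁ (pair v₀ O)
    ∙ ⇒E (∀E (∀E (∀E walk-persists v₁) v₀) (triangle (v₀ +′ O)))
        (⇒E (∀E (∀E walk-hits v₁) v₀) h₀))))

  SEP*⇒reflection : H ⊢[ T ] Σ⁰₁-SEP* ⇒ Σ⁰₁-REFLECTION
  SEP*⇒reflection = ⇒I (∀ˢᵗI (⇒I (raa (∃E
    (⇒E (∀ˢᵗE (∀ˢᵗE h₃ (found · v₀) st-found) (found · v₀) st-found)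
      -- A standard witness m at a standard n would make the walk up to the code of (m, n) end at a
      -- standard zero of g.
      (∀ˢᵗI (⇒I (∃E (∧E₁ h₀) (⇒E h₃ (∃ˢᵗI (walk · v₂ · pair v₀ v₁)
        (st-closed walk ·ˢ h₅ ·ˢ st-pair (∧E₁ h₀) h₂)
        (≐s (found-eq v₂ (pair v₀ v₁)) ∙ ∧E₂ h₀)))))))
    -- Internally the given zero of g is a witness at 0, which puts 0 both outside and inside the
    -- separating set.
    (⇒E (⇒E (∧E₁ (∀E (∧E₂ (∧E₂ h₀)) O)) (∃E h₂ (∃I v₀ (⇒E (∀E (∀E found-at-pair v₂) v₀) h₀))))
      (⇒E (∧E₂ (∀E (∧E₂ (∧E₂ h₀)) O)) (∃E h₂ (∃I v₀ (⇒E (∀E (∀E found-at-pair v₂) v₀) h₀)))))))))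
    where
    st-found : ∀ {H} → A ∷ B ∷ st v₀ ∷ H ⊢[ T ] st (found · v₀)
    st-found = st-closed found ·ˢ h₂

  along-eq : ∀ {Γ H} (Φ : Tm L Γ (𝟏 ⟶ 𝟎 *)) g i →
    H ⊢[ T ] along · Φ · g · i ≐ g · (con (at 𝟎) · (Φ · g) · i)
  along-eq Φ g i = β₃ var (v₁ · (con (at 𝟎) · (v₂ · v₁) · v₀)) Φ g i

  search-eq : ∀ {Γ H} (Φ : Tm L Γ (𝟏 ⟶ 𝟎 *)) g →
    H ⊢[ T ] search · Φ · g ≐ along · Φ · g · (walk · (along · Φ · g) · (con (len 𝟎) · (Φ · g)))
  search-eq Φ g = β₂ var (found · (along · v₁ · v₀) · (con (len 𝟎) · (v₁ · v₀))) Φ g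
    ∙ found-eq (along · Φ · g) (con (len 𝟎) · (Φ · g))

  -- HAC-int bounds a standard zero by a finite sequence of candidates, which search goes through.
  reflection⇒∃² : H ⊢[ T ] Σ⁰₁-REFLECTION ⇒ principle ∃² ˢᵗ
  -- `HAC-int` needs an internal matrix, so y must be a zero only if g has any zero at all.
  -- Reflection then supplies a standard y, and 0 serves when there is no zero.
  reflection⇒∃² = ⇒I (∃E (⇒E (ax (HAC-int ((∃[ 𝟎 ] v₂ · v₀ ≐ O) ⇒ v₁ · v₀ ≐ O) (tt , tt)))
      (∀ˢᵗI (∨E (em (∃[ 𝟎 ] v₁ · v₀ ≐ O))
        (∃E (⇒E (∀ˢᵗE h₂ v₀ h₁) h₀) (∃ˢᵗI v₀ (∧E₁ h₀) (⇒I (∧E₂ h₁))))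
        (∃ˢᵗI O (st-closed O) (⇒I (⊥E (⇒E h₁ h₀)))))))
    (∃ˢᵗI (search · v₀) (st-closed search ·ˢ ∧E₁ h₀) (∀ˢᵗI (∧I
      (⇒I (∃E (∀ˢᵗE (∧E₂ h₂) v₀ h₁) (∃E (∧E₁ h₀) (∃E (∧E₁ h₀)
        (search-eq Φ v₃
        -- The zero is the entry at some index i, and the length is d + (i + 1): the walk is on a
        -- zero at i, hence at i + 1, hence at the length.
        ∙ Eq-ext _ (Eq-ext _ (≐s h₀))
        ∙ ⇒E (∀E (∀E (∀E walk-persists (along · Φ · v₃)) (suc′ v₁)) v₀)
            (walk-stays (⇒E (∀E (∀E walk-hits (along · Φ · v₃)) v₁)
              (along-eq Φ v₃ v₁ ∙ Eq-ext v₃ (≐s (∧E₂ h₁))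
              ∙ ⇒E (∧E₂ h₂) (∃E h₃ (∃I v₀ (∧E₂ h₀)))))))))))
      -- This entry may lie past the end of the list, but it is standard in any case, and the value
      -- of `search` says that it is a zero.
      (⇒I (∃ˢᵗI (con (at 𝟎) · (v₁ · v₀) · (walk · (along · v₁ · v₀) · (con (len 𝟎) · (v₁ · v₀))))
        (st-closed (con (at 𝟎)) ·ˢ (∧E₁ h₂ ·ˢ h₁)
          ·ˢ (st-closed walk ·ˢ (st-closed along ·ˢ ∧E₁ h₂ ·ˢ h₁)
            ·ˢ (st-closed (con (len 𝟎)) ·ˢ (∧E₁ h₂ ·ˢ h₁))))
        (≐s (along-eq v₁ v₀ _) ∙ ≐s (search-eq v₁ v₀) ∙ h₀)))))))
    where
    Φ : ∀ {a b c d e} → Tm L (a ∷ b ∷ c ∷ d ∷ e ∷ Γ) e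
    Φ = wk v₃

  -- The constant for (∃²)

  Ξ₀ : Tm L Γ 𝟐
  Ξ₀ = con (Ξ nothing)

  Decides : Tm L Γ 𝟐 → Fm L Γ
  Decides φ = ∀ˢᵗ[ 𝟏 ] (∃ˢᵗ[ 𝟎 ] v₁ · v₀ ≐ O) ⇔ wk φ · v₀ ≐ O

  Ξ₀-STANDARD Ξ₀-COMPLETE Ξ₀-INTERNAL : Fm L Γ
  Ξ₀-STANDARD = Decides Ξ₀
  Ξ₀-COMPLETE = ∀[ 𝟏 ] ∀[ 𝟎 ] v₁ · v₀ ≐ O ⇒ Ξ₀ · v₁ ≐ O
  Ξ₀-INTERNAL = ∀[ 𝟏 ] (∃[ 𝟎 ] v₁ · v₀ ≐ O) ⇔ Ξ₀ · v₀ ≐ O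

  ⇔-resp : {a b : Tm L Γ 𝟎} → H ⊢[ T ] (A ⇔ a ≐ O) ⇒ (b ≐ O ⇒ a ≐ O) ⇒ (a ≐ O ⇒ b ≐ O) ⇒ (A ⇔ b ≐ O)
  ⇔-resp = ⇒I (⇒I (⇒I (∧I
    (⇒I (⇒E h₁ (⇒E (∧E₁ h₃) h₀)))
    (⇒I (⇒E (∧E₂ h₃) (⇒E h₂ h₀))))))

  -- The specification of `Ξ₀` admits only the values 0 and 1, so the given functional is first
  -- replaced by its `normalize`, which has the same zeros.
  ∃²⇒Ξ₀-standard : H ⊢[ T ] principle ∃² ˢᵗ ⇒ Ξ₀-STANDARD
  ∃²⇒Ξ₀-standard = ⇒I (∃E h₀ (∀ˢᵗI (⇒E
    (⇒I (⇒E (⇒E (⇒E ⇔-resp (∀ˢᵗE (∧E₂ h₂) v₀ h₁))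
      (⇒I (⇒E cond-0-1 (≐s (normalize-eq v₁ v₀) ∙ ≐s h₁ ∙ h₀))))
      (⇒I (h₁ ∙ normalize-eq v₁ v₀ ∙ cond-zero h₀))))
    (∀ˢᵗE (⇒E (∀ˢᵗE (∧E₂ (ax (Ξ-spec nothing))) (normalize · v₁) (st-closed normalize ·ˢ ∧E₁ h₁))
      (∀ˢᵗI (∧I
        (⇒E (⇒E (⇒E ⇔-resp (∀ˢᵗE (∧E₂ h₂) v₀ h₀))
          (⇒I (⇒E cond-0-1 (≐s (normalize-eq v₂ v₀) ∙ h₀))))
          (⇒I (normalize-eq v₂ v₀ ∙ cond-zero h₀)))
        (∨E (em (v₂ · v₀ ≐ O))
          (∨I₁ (normalize-eq v₂ v₀ ∙ cond-zero h₀))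
          (∨I₂ (normalize-eq v₂ v₀ ∙ cond-pos h₀))))))
      v₀ h₀))))

  tail-eq : ∀ {Γ H} (x : Tm L Γ 𝟏) k → H ⊢[ T ] tail · x · k ≐ x · suc′ k
  tail-eq x k = β₂ var (v₁ · suc′ v₀) x k

  cons-eq : ∀ {Γ H} (n : Tm L Γ 𝟎) g k →
    H ⊢[ T ] cons · n · g · k ≐ con R₀ · k · n · (con (Πᶜ 𝟏 𝟎) · g)
  cons-eq n g k = β₃ var (con R₀ · v₀ · v₂ · (con (Πᶜ 𝟏 𝟎) · v₁)) n g k

  cons-zero : ∀ {Γ H} (n : Tm L Γ 𝟎) g → H ⊢[ T ] cons · n · g · O ≐ n
  cons-zero n g = cons-eq n g O ∙ ax (base (R₀-zero n _))

  cons-suc : ∀ {Γ H} (n : Tm L Γ 𝟎) g k → H ⊢[ T ] cons · n · g · suc′ k ≐ g · k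
  cons-suc n g k = cons-eq n g (suc′ k) ∙ ax (base (R₀-suc k n _))
    ∙ Eq-app {τ = 𝟎} _ _ k (ax (base (Π-eq g _)))

  -- PF-TP∀ admits only one variable, hence the pair (n , g) is coded as cons n g.
  Ξ₀-complete : H ⊢[ T ] Ξ₀-STANDARD ⇒ Ξ₀-COMPLETE
  Ξ₀-complete = ⇒I (⇒E
    -- `tail · (cons · n · g)` equals g only pointwise; extensionality of `Ξ₀` identifies the
    -- values.
    (⇒I (∀I (∀I (⇒I (≐s (Eq-ext Ξ₀ {cons-tail} {v₁} (∀I (tail-eq _ v₀ ∙ cons-suc v₁ v₂ v₀)))
      ∙ ⇒E (∀E h₁ (cons · v₀ · v₁))
          (Eq-ext _ (Eq-ext _ (cons-zero v₀ v₁)) ∙ cons-suc v₀ v₁ v₀ ∙ h₀))))))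
    (⇒E (ax (PF-TP∀ (v₀ · suc′ (v₀ · O) ≐ O ⇒ Ξ₀ · (tail · v₀) ≐ O) (tt , tt)))
      (∀ˢᵗI (⇒I (⇒E (∧E₁ (∀ˢᵗE h₂ (tail · v₀) (st-closed tail ·ˢ h₁)))
        (∃ˢᵗI (v₀ · O) (h₁ ·ˢ st-closed O) (tail-eq v₀ (v₀ · O) ∙ h₀)))))))
    where
    cons-tail : ∀ {Γ} → Tm L (𝟎 ∷ 𝟏 ∷ Γ) 𝟏
    cons-tail = tail · (cons · v₀ · v₁)

  -- The backward direction transfers as it stands. In the forward one the zero of a standard g may
  -- be nonstandard, so it must be transferred as an input along with g, as in `Ξ₀-complete`.
  Ξ₀-internal : H ⊢[ T ] Ξ₀-STANDARD ⇒ Ξ₀-INTERNAL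
  Ξ₀-internal = ⇒I (∀I (∧I
    (⇒I (∃E h₀ (⇒E (∀E (∀E (⇒E Ξ₀-complete h₂) v₁) v₀) h₀)))
    (∀E (⇒E (ax (PF-TP∀ (Ξ₀ · v₀ ≐ O ⇒ (∃[ 𝟎 ] v₁ · v₀ ≐ O)) (tt , tt)))
      (∀ˢᵗI (⇒I (∃E (⇒E (∧E₂ (∀ˢᵗE h₂ v₀ h₁)) h₀) (∃I v₀ (∧E₂ h₀)))))) v₀)))

  Ξ₀-reflection : H ⊢[ T ] Ξ₀-STANDARD ⇒ Σ⁰₁-REFLECTION
  Ξ₀-reflection = ⇒I (∀ˢᵗI (⇒I (⇒E (∧E₂ (∀ˢᵗE h₂ v₀ h₁))
    (⇒E (∧E₁ (∀E (⇒E Ξ₀-internal h₂) v₀)) h₀))))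

  -- Separation at all numbers

  Ξ₀-section : ∀ {Γ} {H : List (Fm L Γ)} →
    H ⊢[ T ] Ξ₀-INTERNAL ⇒ (∀[ 𝟏 ] ∀[ 𝟎 ] Σ⁰₁ v₁ v₀ ⇒ Ξ₀ · (section · v₁ · v₀) ≐ O)
  Ξ₀-section = ⇒I (∀I (∀I (⇒I (⇒E (∧E₁ (∀E h₁ (section · v₁ · v₀)))
    (∃E h₀ (∃I v₀ (section-eq v₂ v₁ v₀ ∙ h₀)))))))

  decides-section : ∀ {Γ} {H : List (Fm L Γ)} →
    H ⊢[ T ] ∀[ 𝟐 ] Decides v₀ ⇒
      (∀ˢᵗ[ 𝟏 ] ∀ˢᵗ[ 𝟎 ] (Σ⁰₁ v₁ v₀) ˢᵗ ⇔ v₂ · (section · v₁ · v₀) ≐ O)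
  decides-section = ∀I (⇒I (∀ˢᵗI (∀ˢᵗI (⇒E
    (⇒I (∧I
      (⇒I (⇒E (∧E₁ h₁) (∃E h₀ (∃ˢᵗI v₀ (∧E₁ h₀) (section-eq v₂ v₁ v₀ ∙ ∧E₂ h₀)))))
      (⇒I (∃E (⇒E (∧E₂ h₁) h₀) (∃ˢᵗI v₀ (∧E₁ h₀) (≐s (section-eq v₂ v₁ v₀) ∙ ∧E₂ h₀))))))
    (∀ˢᵗE h₂ (section · v₁ · v₀) (st-closed section ·ˢ h₁ ·ˢ h₀))))))

  both-Σ⁰₁ : Tm L Γ (𝟏 ⟶ 𝟏 ⟶ 𝟏)
  both-Σ⁰₁ = lam (lam (lam (cond (Ξ₀ · (section · v₂ · v₀)) (Ξ₀ · (section · v₁ · v₀)) 𝟙)))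

  both-Σ⁰₁-eq : ∀ {Γ H} (f g : Tm L Γ 𝟏) n →
    H ⊢[ T ] both-Σ⁰₁ · f · g · n ≐ cond (Ξ₀ · (section · f · n)) (Ξ₀ · (section · g · n)) 𝟙
  both-Σ⁰₁-eq f g n =
    β₃ var (cond (Ξ₀ · (section · v₂ · v₀)) (Ξ₀ · (section · v₁ · v₀)) 𝟙) f g n

  cond-1⁻ : ∀ {Γ H} {n a : Tm L Γ 𝟎} → H ⊢[ T ] cond n a 𝟙 ≐ O ⇒ n ≐ O ∧ a ≐ O
  cond-1⁻ = ⇒I (∨E (em _)
    (∧I h₀ (≐s (cond-zero h₀) ∙ h₁))
    (1≢0 (≐s (cond-pos h₀) ∙ h₁)))

  -- A number satisfying both formulas is a zero of the standard function `both-Σ⁰₁ · f₁ · f₂`, so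
  -- reflection gives a standard such number, at which `Ξ₀` also yields standard witnesses.
  disjoint-everywhere : ∀ {Γ} {H : List (Fm L Γ)} →
    H ⊢[ T ] Ξ₀-STANDARD ⇒ (∀ˢᵗ[ 𝟏 ] ∀ˢᵗ[ 𝟏 ]
      (∀ˢᵗ[ 𝟎 ] ¬′ (Σ⁰₁ v₂ v₀ ˢᵗ ∧ Σ⁰₁ v₁ v₀ ˢᵗ)) ⇒ (∀[ 𝟎 ] ¬′ (Σ⁰₁ v₂ v₀ ∧ Σ⁰₁ v₁ v₀)))
  disjoint-everywhere = ⇒I (∀ˢᵗI (∀ˢᵗI (⇒I (∀I (⇒I (∃E
    (⇒E (∀ˢᵗE (⇒E Ξ₀-reflection h₄) (both-Σ⁰₁ · v₂ · v₁) (st-closed both-Σ⁰₁ ·ˢ h₃ ·ˢ h₂))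
      (∃I v₀ (both-Σ⁰₁-eq v₂ v₁ v₀
        ∙ cond-zero (⇒E (∀E (∀E (⇒E Ξ₀-section (⇒E Ξ₀-internal h₄)) v₂) v₀) (∧E₁ h₀))
        ∙ ⇒E (∀E (∀E (⇒E Ξ₀-section (⇒E Ξ₀-internal h₄)) v₁) v₀) (∧E₂ h₀))))
    (⇒E (⇒I (⇒E (∀ˢᵗE h₃ v₀ (∧E₁ h₁))
        (∧I (⇒E (∧E₂ (∀ˢᵗE (∀ˢᵗE (⇒E (∀E decides-section Ξ₀) h₆) v₃ h₅) v₀ (∧E₁ h₁))) (∧E₁ h₀))
          (⇒E (∧E₂ (∀ˢᵗE (∀ˢᵗE (⇒E (∀E decides-section Ξ₀) h₆) v₂ h₄) v₀ (∧E₁ h₁))) (∧E₂ h₀)))))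
      (⇒E cond-1⁻ (≐s (both-Σ⁰₁-eq v₃ v₂ v₀) ∙ ∧E₂ h₀)))))))))

  Ξ₀⇒SEP* : H ⊢[ T ] Ξ₀-STANDARD ⇒ Σ⁰₁-SEP*
  Ξ₀⇒SEP* = ⇒I (∀ˢᵗI (∀ˢᵗI (⇒I (∃ˢᵗI (separator · Ξ₀ · v₀)
    (st-closed separator ·ˢ st-closed Ξ₀ ·ˢ h₁)
    (∧I (∀I (∨E (em (Ξ₀ · (section · v₁ · v₀) ≐ O))
        (∨I₂ (separator-eq Ξ₀ v₁ v₀ ∙ cond-zero h₀))
        (∨I₁ (separator-eq Ξ₀ v₁ v₀ ∙ cond-pos h₀))))
      (∀I (∧I
        (⇒I (⇒I (⇒E
          (∀E (⇒E (∀ˢᵗE (∀ˢᵗE (⇒E disjoint-everywhere h₅) v₂ h₄) v₁ h₃) h₂) v₀)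
          (∧I h₁ (∃E
            (⇒E (∧E₂ (∀E (⇒E Ξ₀-internal h₅) (section · v₁ · v₀)))
              (⇒E cond-1-0 (≐s (separator-eq Ξ₀ v₁ v₀) ∙ h₀)))
            (∃I v₀ (≐s (section-eq v₂ v₁ v₀) ∙ h₀)))))))
        (⇒I (separator-eq Ξ₀ v₁ v₀ ∙ cond-zero
          (⇒E (∀E (∀E (⇒E Ξ₀-section (⇒E Ξ₀-internal h₄)) v₁) v₀) h₀))))))))))

  -- Uniform separation from (∃²)

  uniform-separator-eq : ∀ {Γ H} (φ : Tm L Γ 𝟐) f g n →
    H ⊢[ T ] uniform-separator · φ · f · g · n ≐ cond (φ · (section · f · n)) 𝟙 O
  uniform-separator-eq φ f g n =
    Eq-app {τ = 𝟎} (uniform-separator · φ · f · g) (separator · φ · f) n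
      (β₃ var (separator · v₂ · v₁) φ f g) ∙ separator-eq φ f n

  cond-resp : ∀ {Γ H} {m n a b : Tm L Γ 𝟎} → H ⊢[ T ] (m ≐ O ⇔ n ≐ O) ⇒ cond m a b ≐ cond n a b
  cond-resp = ⇒I (∨E (em _)
    (cond-zero h₀ ∙ ≐s (cond-zero (⇒E (∧E₁ h₁) h₀)))
    (cond-pos h₀ ∙ ≐s (cond-pos (⇒I (⇒E h₁ (⇒E (∧E₂ h₂) h₀))))))

  Σ⁰₁-resp-≈ : ∀ {Γ} {H : List (Fm L Γ)} →
    H ⊢[ T ] ∀ˢᵗ[ 𝟏 ] ∀ˢᵗ[ 𝟏 ] v₁ ≈ v₀ ⇒ (∀ˢᵗ[ 𝟎 ] Σ⁰₁ v₂ v₀ ˢᵗ ⇒ Σ⁰₁ v₁ v₀ ˢᵗ)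
  Σ⁰₁-resp-≈ = ∀ˢᵗI (∀ˢᵗI (⇒I (∀ˢᵗI (⇒I (∃E h₀ (∃ˢᵗI v₀ (∧E₁ h₀)
    (≐s (∀ˢᵗE h₃ (pair v₀ v₁) (st-pair (∧E₁ h₀) h₂)) ∙ ∧E₂ h₀)))))))

  -- Extensionality of φ with respect to `≈` is not assumed: its zeros are fixed by a property that
  -- sees only standard values.
  decides-section-resp-≈ : ∀ {Γ} {H : List (Fm L Γ)} →
    H ⊢[ T ] ∀[ 𝟐 ] Decides v₀ ⇒ (∀ˢᵗ[ 𝟏 ] ∀ˢᵗ[ 𝟏 ] v₁ ≈ v₀ ⇒
      (∀ˢᵗ[ 𝟎 ] v₃ · (section · v₂ · v₀) ≐ O ⇒ v₃ · (section · v₁ · v₀) ≐ O))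
  decides-section-resp-≈ = ∀I (⇒I (∀ˢᵗI (∀ˢᵗI (⇒I (∀ˢᵗI (⇒I (⇒E
    (∧E₁ (∀ˢᵗE (∀ˢᵗE (⇒E (∀E decides-section v₃) h₅) v₁ h₃) v₀ h₁))
    (⇒E (∀ˢᵗE (⇒E (∀ˢᵗE (∀ˢᵗE Σ⁰₁-resp-≈ v₂ h₄) v₁ h₃) h₂) v₀ h₁)
      (⇒E (∧E₂ (∀ˢᵗE (∀ˢᵗE (⇒E (∀E decides-section v₃) h₅) v₂ h₄) v₀ h₁)) h₀)))))))))

  ∃²⇒UΣ⁰₁-SEP : H ⊢[ T ] principle ∃² ˢᵗ ⇒ E-st UΣ⁰₁-SEP
  ∃²⇒UΣ⁰₁-SEP = ⇒I (∃E h₀ (∃ˢᵗI (uniform-separator · v₀) (st-closed uniform-separator ·ˢ ∧E₁ h₀)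
    (∧I
      (∀ˢᵗI (∀ˢᵗI (⇒I (∧I
        (∀ˢᵗI (⇒I (uniform-separator-eq v₃ v₂ v₁ v₀ ∙ cond-zero (⇒E
          (∧E₁ (∀ˢᵗE (∀ˢᵗE (⇒E (∀E decides-section v₃) (∧E₂ h₅)) v₂ h₄) v₀ h₁)) h₀))))
        (∀ˢᵗI (⇒I (uniform-separator-eq v₃ v₂ v₁ v₀ ∙ cond-pos (⇒I (⇒E (∀ˢᵗE h₃ v₀ h₂) (∧I
          (⇒E (∧E₂ (∀ˢᵗE (∀ˢᵗE (⇒E (∀E decides-section v₃) (∧E₂ h₆)) v₂ h₅) v₀ h₂)) h₀)
          h₁))))))))))
      (∧I
        (∀ˢᵗI (∀ˢᵗI (⇒I (∀ˢᵗI (∀ˢᵗI (uniform-separator-eq (wk v₃) v₃ v₁ v₀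
          ∙ ⇒E cond-resp (∧I
              (∀ˢᵗE (⇒E (∀ˢᵗE (∀ˢᵗE (⇒E (∀E decides-section-resp-≈ (wk v₃)) (∧E₂ h₅)) v₃ h₄) v₂ h₃)
                h₂) v₀ h₀)
              (∀ˢᵗE (⇒E (∀ˢᵗE (∀ˢᵗE (⇒E (∀E decides-section-resp-≈ (wk v₃)) (∧E₂ h₅)) v₂ h₃) v₃ h₄)
                (∀ˢᵗI (≐s (∀ˢᵗE h₃ v₀ h₀)))) v₀ h₀))
          ∙ ≐s (uniform-separator-eq (wk v₃) v₂ v₁ v₀)))))))
        -- The separator reads only f, so replacing g leaves the value unchanged.
        (∀ˢᵗI (∧I
          (∀ˢᵗI (∀ˢᵗI (⇒I (∀ˢᵗI (uniform-separator-eq (wk v₃) v₃ v₂ v₀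
            ∙ ≐s (uniform-separator-eq (wk v₃) v₃ v₁ v₀))))))
          (∀ˢᵗI (∧I
            (∀ˢᵗI (∀ˢᵗI (⇒I (Eq-ext _ h₀))))
            (∀ˢᵗI (⇒I h₀))))))))))

  -- Recovering (∃²) from uniform separation

  one-nonzero : ∀ {Γ H} {A : Fm L Γ} {k : Tm L Γ 𝟎} → H ⊢[ T ] one · k ≐ O → H ⊢[ T ] A
  one-nonzero {k = k} p = 1≢0 (≐s (ax (base (Π-eq 𝟙 k))) ∙ p)

  found-sign-eq : ∀ {Γ H} (g : Tm L Γ 𝟏) k →
    H ⊢[ T ] found-sign · g · k ≐ cond (g · (walk · g · k)) O 𝟙
  found-sign-eq g k = β₂ var (cond (found · v₁ · v₀) O 𝟙) g k
    ∙ ⇒E cond-resp (∧I (⇒I (≐s (found-eq g k) ∙ h₀)) (⇒I (found-eq g k ∙ h₀)))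

  found-sign-zero : ∀ {Γ} {H : List (Fm L Γ)} →
    H ⊢[ T ] ∀ˢᵗ[ 𝟏 ] (∃ˢᵗ[ 𝟎 ] v₁ · v₀ ≐ O) ⇒ Σ⁰₁ (found-sign · v₀) O ˢᵗ
  found-sign-zero = ∀ˢᵗI (⇒I (∃E h₀ (∃ˢᵗI v₀ (∧E₁ h₀) (found-sign-eq v₁ (pair v₀ O)
    ∙ cond-zero (≐s (found-eq v₁ (pair v₀ O))
        ∙ ⇒E (∀E (∀E found-at-pair v₁) v₀) (∧E₂ h₀))))))

  -- For standard k the walk ends at a standard number, hence at a non-zero of g.
  found-sign-one : ∀ {Γ} {H : List (Fm L Γ)} →
    H ⊢[ T ] ∀ˢᵗ[ 𝟏 ] ¬′ (∃ˢᵗ[ 𝟎 ] v₁ · v₀ ≐ O) ⇒ found-sign · v₀ ≈ one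
  found-sign-one = ∀ˢᵗI (⇒I (∀ˢᵗI (found-sign-eq v₁ v₀
    ∙ cond-pos (⇒I (⇒E h₂ (∃ˢᵗI (walk · v₁ · v₀) (st-closed walk ·ˢ h₃ ·ˢ h₁) h₀)))
    ∙ ≐s (ax (base (Π-eq 𝟙 v₀))))))

  test-left-eq : ∀ {Γ H} (F : Tm L Γ (𝟏 ⟶ 𝟏 ⟶ 𝟎 ⟶ 𝟎)) g →
    H ⊢[ T ] test-left · F · g ≐ cond (F · (found-sign · g) · one · O) 𝟙 O
  test-left-eq F g = β₂ var (cond (v₁ · (found-sign · v₀) · one · O) 𝟙 O) F g

  test-right-eq : ∀ {Γ H} (F : Tm L Γ (𝟏 ⟶ 𝟏 ⟶ 𝟎 ⟶ 𝟎)) g →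
    H ⊢[ T ] test-right · F · g ≐ F · one · (found-sign · g) · O
  test-right-eq F g = β₂ var (v₁ · one · (found-sign · v₀) · O) F g

  st-found-sign : {g : Tm L Γ 𝟏} → H ⊢[ T ] st g → H ⊢[ T ] st (found-sign · g)
  st-found-sign p = st-closed found-sign ·ˢ p

  st-one : {Γ : Cxt} {H : List (Fm L Γ)} → H ⊢[ T ] st one
  st-one = st-closed one

  UΣ⁰₁-SEP⇒∃² : H ⊢[ T ] E-st UΣ⁰₁-SEP ⇒ principle ∃² ˢᵗ
  UΣ⁰₁-SEP⇒∃² = ⇒I (∃E h₀ (∨E (em (v₀ · one · one · O ≐ O))
    -- Here F(1, 1, 0) = 0, so F(f, 1, 0) is 1 or 0 according as g has a standard zero or not;
    -- `test-left` swaps the two values.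
    (∃ˢᵗI (test-left · v₀) (st-closed test-left ·ˢ ∧E₁ h₁) (∀ˢᵗI (∧I
      (⇒I (test-left-eq v₁ v₀ ∙ cond-pos (⇒I (1≢0 (≐s
        (⇒E (∀ˢᵗE (∧E₁ (⇒E
          (∀ˢᵗE (∀ˢᵗE (∧E₁ (∧E₂ h₄)) (found-sign · v₀) (st-found-sign h₂)) one st-one)
          (∀ˢᵗI (⇒I (∃E (∧E₂ h₀) (one-nonzero (∧E₂ h₀))))))) O (st-closed O))
          (⇒E (∀ˢᵗE found-sign-zero v₀ h₂) h₁))
        ∙ h₀)))))
      (⇒I (raa (1≢0 (≐s (cond-zero
        (∀ˢᵗE (∀ˢᵗE (⇒E (∀ˢᵗE (∀ˢᵗE (∧E₁ (∧E₂ (∧E₂ h₄)))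
            (found-sign · v₀) (st-found-sign h₂)) one st-one)
          (⇒E (∀ˢᵗE found-sign-one v₀ h₂) h₀)) one st-one) O (st-closed O)
        ∙ h₃)) ∙ ≐s (test-left-eq v₁ v₀) ∙ h₁)))))))
    -- Here F(1, 1, 0) is non-zero, so F(1, f, 0) is already zero exactly when g has a standard
    -- zero.
    (∃ˢᵗI (test-right · v₀) (st-closed test-right ·ˢ ∧E₁ h₁) (∀ˢᵗI (∧I
      (⇒I (test-right-eq v₁ v₀
        ∙ ⇒E (∀ˢᵗE (∧E₂ (⇒E
            (∀ˢᵗE (∀ˢᵗE (∧E₁ (∧E₂ h₃)) one st-one) (found-sign · v₀) (st-found-sign h₁))
            (∀ˢᵗI (⇒I (∃E (∧E₁ h₀) (one-nonzero (∧E₂ h₀))))))) O (st-closed O))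
          (⇒E (∀ˢᵗE found-sign-zero v₀ h₁) h₀)))
      (⇒I (raa (⇒E h₃
        (≐s (∀ˢᵗE (⇒E (∀ˢᵗE (∀ˢᵗE (∧E₁ (∀ˢᵗE (∧E₂ (∧E₂ (∧E₂ h₄))) one st-one))
            (found-sign · v₀) (st-found-sign h₂)) one st-one)
          (⇒E (∀ˢᵗE found-sign-one v₀ h₂) h₀)) O (st-closed O))
        ∙ ≐s (test-right-eq v₁ v₀) ∙ h₁)))))))))

  -- The cycle of implications

  compose : H ⊢[ T ] (A ⇒ B) ⇒ (B ⇒ C) ⇒ A ⇒ C
  compose = ⇒I (⇒I (⇒I (⇒E h₁ (⇒E h₂ h₀))))

  infixr 4 _⨾_
  _⨾_ : H ⊢[ T ] A ⇒ B → H ⊢[ T ] B ⇒ C → H ⊢[ T ] A ⇒ C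
  p ⨾ q = ⇒E (⇒E compose p) q

  TRANS⇔SEP* : [] ⊢[ T ] Π⁰₁-TRANS ⇔ Σ⁰₁-SEP*
  TRANS⇔SEP* = ∧I
    (TRANS⇒reflection ⨾ reflection⇒∃² ⨾ ∃²⇒Ξ₀-standard ⨾ Ξ₀⇒SEP*)
    (SEP*⇒reflection ⨾ reflection⇒TRANS)

  SEP*⇔UΣ⁰₁-SEP : [] ⊢[ T ] Σ⁰₁-SEP* ⇔ E-st UΣ⁰₁-SEP
  SEP*⇔UΣ⁰₁-SEP = ∧I
    (SEP*⇒reflection ⨾ reflection⇒∃² ⨾ ∃²⇒UΣ⁰₁-SEP)
    (UΣ⁰₁-SEP⇒∃² ⨾ ∃²⇒Ξ₀-standard ⨾ Ξ₀⇒SEP*)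

  UΣ⁰₁-SEP⇔∃² : [] ⊢[ T ] E-st UΣ⁰₁-SEP ⇔ principle ∃² ˢᵗ
  UΣ⁰₁-SEP⇔∃² = ∧I UΣ⁰₁-SEP⇒∃² ∃²⇒UΣ⁰₁-SEP

theorem3p8 : {I : Set} (spec : I → Specification) →
    (RCA₀Ω spec ⊢ (Π⁰₁-TRANS ⇔ Σ⁰₁-SEP*)) ×
    (RCA₀Ω spec ⊢ (Σ⁰₁-SEP* ⇔ E-st UΣ⁰₁-SEP)) ×
    (RCA₀Ω spec ⊢ (E-st UΣ⁰₁-SEP ⇔ principle ∃² ˢᵗ))
theorem3p8 spec = TRANS⇔SEP* , SEP*⇔UΣ⁰₁-SEP , UΣ⁰₁-SEP⇔∃²
  where open Derivations spec
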